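{- Let $3 \leq p \leq q$ be integers. Then $K_{p,q}^+$ is not determined by its spectrum if and only if the quadratic equation $x^2 - (q+3)x + (pq+2) = 0$ has two integral roots $p'' \leq q''$ both lying in $[2,\infty)$. Moreover, if $K_{p,q}^+$ is not determined by its spectrum, then $K_{p'',q''}^- \cup (p-2)K_1$ is the unique (up to isomorphism) graph that is cospectral with but not isomorphic to $K_{p,q}^+$.
   Context: All graphs are simple. The spectrum of a graph is the multiset of eigenvalues of its adjacency matrix. Two graphs are cospectral if they have the same spectrum (in particular the same number of vertices). A graph $G$ is determined by its spectrum (DS) if every graph cospectral with $G$ is isomorphic to $G$. $K_{p,q}$ denotes the complete bipartite graph with parts of sizes $p$ and $q$. For $2 \leq \min\{p,q\}$, $K_{p,q}^-$ denotes the graph obtained from $K_{p,q}$ by deleting one edge, and $K_{p,q}^+$ denotes the graph obtained from $K_{p,q}$ by adding a new vertex $x$ and a new edge $xy$, where $y$ is a vertex in the part of size $\min\{p,q\}$. $\cup$ denotes disjoint union and $mK_1$ denotes $m$ isolated vertices. -}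

module Defs where

open import Data.Nat as ℕ using (ℕ; zero; suc; _+_; _*_; _∸_; _≤_; _<ᵇ_; _≡ᵇ_)
open import Data.Integer as ℤ using (ℤ; +_; -_)
open import Data.Bool using (Bool; true; false; _∧_; _∨_; not; if_then_else_)
open import Data.Bool.Properties using (∨-comm; ∧-zeroʳ)
open import Data.Fin using (Fin; zero; suc; toℕ; punchIn; _≟_)
open import Data.List using (List; []; _∷_)
open import Data.Product using (Σ; _×_; _,_)
open import Function.Bundles using (_↔_; Inverse)
open import Relation.Nullary using (¬_)
open import Relation.Nullary.Decidable using (⌊_⌋)
open import Relation.Binary.PropositionalEquality using (_≡_; refl; cong₂; trans) renaming (sym to ≡sym)

record Graph (n : ℕ) : Set where
  field
    adj   : Fin n → Fin n → Bool
    sym   : ∀ i j → adj i j ≡ adj j i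
    irrefl : ∀ i → adj i i ≡ false
open Graph public

mkGraph : ∀ {n} → (Fin n → Fin n → Bool) → Graph n
mkGraph {n} e = record { adj = a ; sym = s ; irrefl = r }
  where
  a : Fin n → Fin n → Bool
  a i j = (e i j ∨ e j i) ∧ not ⌊ i ≟ j ⌋
  s : ∀ i j → a i j ≡ a j i
  s i j with i ≟ j | j ≟ i
  ... | Relation.Nullary.yes _ | Relation.Nullary.yes _ = trans (∧-zeroʳ (e i j ∨ e j i)) (≡sym (∧-zeroʳ (e j i ∨ e i j)))
  ... | Relation.Nullary.yes p | Relation.Nullary.no q = Data.Empty.⊥-elim (q (≡sym p))
    where import Data.Empty
  ... | Relation.Nullary.no p | Relation.Nullary.yes q = Data.Empty.⊥-elim (p (≡sym q))
    where import Data.Empty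
  ... | Relation.Nullary.no _ | Relation.Nullary.no _ = cong₂ _∧_ (∨-comm (e i j) (e j i)) refl
  r : ∀ i → a i i ≡ false
  r i with i ≟ i
  ... | Relation.Nullary.yes _ = Data.Bool.Properties.∧-zeroʳ (e i i ∨ e i i)
    where import Data.Bool.Properties
  ... | Relation.Nullary.no p = Data.Empty.⊥-elim (p refl)
    where import Data.Empty

_≅_ : ∀ {n m} → Graph n → Graph m → Set
_≅_ {n} {m} G H = Σ (Fin n ↔ Fin m) λ σ →
  ∀ i j → adj G i j ≡ adj H (Inverse.to σ i) (Inverse.to σ j)

-- Integer polynomials as coefficient lists (lowest degree first)

Poly : Set
Poly = List ℤ

infixl 6 _+P_
infixl 7 _*P_ _·P_

_+P_ : Poly → Poly → Poly
[] +P q = q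
(a ∷ p) +P [] = a ∷ p
(a ∷ p) +P (b ∷ q) = (a ℤ.+ b) ∷ (p +P q)

_·P_ : ℤ → Poly → Poly
c ·P [] = []
c ·P (a ∷ p) = (c ℤ.* a) ∷ (c ·P p)

_*P_ : Poly → Poly → Poly
[] *P q = []
(a ∷ p) *P q = (a ·P q) +P (+ 0 ∷ (p *P q))

coeff : Poly → ℕ → ℤ
coeff [] k = + 0
coeff (a ∷ p) zero = a
coeff (a ∷ p) (suc k) = coeff p k

sign : ℕ → ℤ
sign zero = + 1
sign (suc k) = - sign k

-- determinant of a square polynomial matrix, Laplace expansion along row 0
det : ∀ n → (Fin n → Fin n → Poly) → Poly
det zero M = + 1 ∷ []
det (suc n) M = go (suc n) (λ j → j)
  where
  minor : Fin (suc n) → Fin n → Fin n → Poly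
  minor j r c = M (suc r) (punchIn j c)
  go : ∀ k → (Fin k → Fin (suc n)) → Poly
  go zero f = []
  go (suc k) f = go k (λ i → f (suc i))
                 +P (sign (toℕ (f zero)) ·P (M zero (f zero) *P det n (minor (f zero))))

charPoly : ∀ {n} → Graph n → Poly
charPoly {n} G = det n λ i j →
  if ⌊ i ≟ j ⌋ then (+ 0 ∷ + 1 ∷ [])
  else (if adj G i j then (- + 1 ∷ []) else [])

-- Cospectral: same number of vertices and same characteristic polynomial
-- (equivalently, the same multiset of adjacency eigenvalues)
Cospectral : ∀ {n m} → Graph n → Graph m → Set
Cospectral {n} {m} G H = n ≡ m × (∀ k → coeff (charPoly G) k ≡ coeff (charPoly H) k)

DS : ∀ {n} → Graph n → Set
DS {n} G = ∀ {m} (H : Graph m) → Cospectral G H → G ≅ H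

-- K⁺_{p,q}: vertices 0..p-1 (part of size p = min), p..p+q-1 (part of size q),
-- extra vertex x = p+q joined to vertex 0 (in the part of size p).
Kplus : (p q : ℕ) → Graph (p + q + 1)
Kplus p q = mkGraph λ i j →
  let a = toℕ i ; b = toℕ j in
  ((a <ᵇ p) ∧ not (b <ᵇ p) ∧ (b <ᵇ p + q))
  ∨ ((a ≡ᵇ 0) ∧ (b ≡ᵇ p + q))

-- K⁻_{p,q} ∪ r K₁: vertices 0..p-1, p..p+q-1 form K_{p,q} minus the edge {0,p};
-- vertices p+q..p+q+r-1 are isolated.
KminusIso : (p q r : ℕ) → Graph (p + q + r)
KminusIso p q r = mkGraph λ i j →
  let a = toℕ i ; b = toℕ j in
  (a <ᵇ p) ∧ not (b <ᵇ p) ∧ (b <ᵇ p + q) ∧ not ((a ≡ᵇ 0) ∧ (b ≡ᵇ p))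

RootsOf : (p q p'' q'' : ℕ) → Set
RootsOf p q p'' q'' = ∀ (x : ℤ) →
  x ℤ.* x ℤ.- (+ (q + 3)) ℤ.* x ℤ.+ (+ (p * q + 2))
    ≡ (x ℤ.- + p'') ℤ.* (x ℤ.- + q'')

{-# OPTIONS --safe #-}

-- The coefficients of the characteristic polynomial are the sums of the principal minors
-- of minus the adjacency matrix. For K⁺ only those of order 0, 2 and 4 are nonzero, and the
-- same holds for a cospectral graph H. The minors of order 3 are nonpositive, so their sum
-- vanishes only if H has no triangle; in a triangle-free graph the minors of order 5 and 6
-- are nonpositive too, so they all vanish. Some minor of order 4 does not, so H contains an
-- induced P₄ or 2K₂, and the vanishing of all minors of order 6 containing it determines
-- every adjacency from the neighbours in these four vertices: H is a blow-up of the path P₅,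
-- with possibly empty classes and isolated vertices. The coefficients of a blow-up are
-- polynomials in the class sizes, and comparing them with those of K⁺ leaves only K⁺ itself
-- and the blow-ups of P₄ with class sizes 1, b, c, 1 where b + c = q + 1 and b c = (p - 1) q.

module Submission where

open import Defs renaming (sym to adj-sym)
open import Data.Bool as Bool using (Bool; true; false; if_then_else_; _∧_; _∨_; not)
open import Data.Bool.Properties using (∧-conicalˡ; ∧-conicalʳ; ∧-identityʳ; ∧-zeroʳ; ¬-not)
open import Data.Empty using (⊥-elim)
open import Data.Fin as Fin using (Fin; zero; suc; toℕ; fromℕ<; punchIn; _≟_)
open import Data.Fin.Patterns
open import Data.Fin.Permutation using (insert; insert-punchIn)
open import Data.Fin.Properties using (all?; any?; toℕ<n; toℕ-fromℕ<)
open import Data.Integer as ℤ using (ℤ; +_; -[1+_]; -_)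
import Data.Integer.Properties as ℤ
open import Algebra.Properties.AbelianGroup ℤ.+-0-abelianGroup using (inverseˡ-unique)
open import Data.Integer.Tactic.RingSolver using (solve-∀)
open import Data.List using (List; []; _∷_; _++_; tabulate; allFin; map; length; _ʳ++_)
open import Data.List.Properties using (map-tabulate; length-tabulate)
open import Data.List.Relation.Binary.Permutation.Propositional as Perm using (_↭_)
open import Data.List.Relation.Binary.Permutation.Propositional.Properties using (shift; ↭-reverse)
open import Data.List.Relation.Binary.Pointwise as PW using (Pointwise; []; _∷_)
open import Data.List.Relation.Unary.All as All using (All; []; _∷_)
import Data.List.Relation.Unary.All.Properties as All
open import Data.List.Relation.Unary.AllPairs using ([]; _∷_)
open import Data.List.Relation.Unary.Unique.Propositional using (Unique)
open import Data.List.Relation.Unary.Unique.Propositional.Properties using (allFin⁺)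
open import Data.Nat as ℕ using (ℕ; zero; suc; _≤_; _∸_; s≤s; z≤n; _!; _≡ᵇ_; _<ᵇ_)
import Data.Nat.Properties as ℕ
open import Data.Nat.Tactic.RingSolver using () renaming (solve-∀ to solveℕ-∀)
open import Data.Product using (Σ; _×_; _,_; proj₁; proj₂)
open import Data.Sum using (_⊎_; inj₁; inj₂; [_,_]′)
open import Data.Unit using (⊤; tt)
open import Data.Vec as Vec using (Vec; []; _∷_; lookup)
open import Data.Vec.Functional using () renaming (_∷_ to _∷ᶠ_; [] to []ᶠ)
open import Data.Vec.Properties using (lookup∘tabulate)
open import Function using (_∘_; id)
open import Function.Bundles using (_⇔_; _↔_; mk⇔; Inverse)
open import Function.Construct.Identity using (↔-id)
open import Relation.Binary.PropositionalEquality hiding ([_])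
open import Relation.Nullary using (Dec; ¬_; yes; no; contradiction; does)
open import Relation.Nullary.Decidable using (⌊_⌋; from-yes; dec-true; dec-false; _×-dec_; _⊎-dec_)
open ≡-Reasoning

-- Why four vertices decide every adjacency: let B be the adjacency matrix of an induced P₄ or 2K₂,
-- so det B = 1. For vertices u and w with rows r and s of adjacencies to these four, the vanishing
-- minors of order 5 say that the Schur complement of B has zero diagonal. The minor of order 6 is
-- then minus the square of x - s B⁻¹ r, where x is the adjacency of u and w; it vanishes only if x
-- = s B⁻¹ r. The code does not argue with inverses but enumerates all r, s and x and evaluates the
-- minors.
--
-- Sums of minors over vertex sets do not split along the classes of a blow-up. Sums over ordered
-- tuples do, and they are k! times as large because a minor is symmetric in its indices and
-- vanishes on repeated ones. They also give the vanishing of single minors for vertices in any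
-- order.
--
-- The final comparison rests on one number: for K⁺ the number E of edges exceeds the coefficient Q
-- of order 4 by q + 1, whereas Q is of degree 4 in the class sizes and overtakes E - 2 as soon as
-- enough classes are large.

-- Polynomials as functions on the integers

module Evaluation where

  open import Data.Integer using (_+_; _*_; _-_)

  eval : Poly → ℤ → ℤ
  eval []      t = + 0
  eval (a ∷ p) t = a + t * eval p t

  eval-+P : ∀ p q t → eval (p +P q) t ≡ eval p t + eval q t
  eval-+P []      q       t = sym (ℤ.+-identityˡ (eval q t))
  eval-+P (a ∷ p) []      t = sym (ℤ.+-identityʳ _)
  eval-+P (a ∷ p) (b ∷ q) t =
    trans (cong (λ x → a + b + t * x) (eval-+P p q t)) (lem a b t (eval p t) (eval q t))
    where
    lem : ∀ a b t x y → a + b + t * (x + y) ≡ a + t * x + (b + t * y)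
    lem = solve-∀

  eval-·P : ∀ c p t → eval (c ·P p) t ≡ c * eval p t
  eval-·P c []      t = sym (ℤ.*-zeroʳ c)
  eval-·P c (a ∷ p) t =
    trans (cong (λ x → c * a + t * x) (eval-·P c p t)) (lem c a t (eval p t))
    where
    lem : ∀ c a t x → c * a + t * (c * x) ≡ c * (a + t * x)
    lem = solve-∀

  eval-*P : ∀ p q t → eval (p *P q) t ≡ eval p t * eval q t
  eval-*P []      q t = refl
  eval-*P (a ∷ p) q t = begin
    eval (a ·P q +P (+ 0 ∷ (p *P q))) t
      ≡⟨ eval-+P (a ·P q) _ t ⟩
    eval (a ·P q) t + (+ 0 + t * eval (p *P q) t)
      ≡⟨ cong₂ (λ x y → x + (+ 0 + t * y)) (eval-·P a q t) (eval-*P p q t) ⟩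
    a * eval q t + (+ 0 + t * (eval p t * eval q t))
      ≡⟨ lem a t (eval p t) (eval q t) ⟩
    (a + t * eval p t) * eval q t ∎
    where
    lem : ∀ a t x y → a * y + (+ 0 + t * (x * y)) ≡ (a + t * x) * y
    lem = solve-∀

  coeff-+P : ∀ p q k → coeff (p +P q) k ≡ coeff p k + coeff q k
  coeff-+P []      q       k       = sym (ℤ.+-identityˡ _)
  coeff-+P (a ∷ p) []      k       = sym (ℤ.+-identityʳ _)
  coeff-+P (a ∷ p) (b ∷ q) zero    = refl
  coeff-+P (a ∷ p) (b ∷ q) (suc k) = coeff-+P p q k

  coeff-·P : ∀ c p k → coeff (c ·P p) k ≡ c * coeff p k
  coeff-·P c []      k       = sym (ℤ.*-zeroʳ c)
  coeff-·P c (a ∷ p) zero    = refl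
  coeff-·P c (a ∷ p) (suc k) = coeff-·P c p k

  -- A constant term a = - t x with t = |a| + 1 is a multiple of t smaller than t.
  multiple-small : ∀ a x → a + + suc ℤ.∣ a ∣ * x ≡ + 0 → a ≡ + 0
  multiple-small a x e = ℤ.∣i∣≡0⇒i≡0 (small ℤ.∣ a ∣ ℤ.∣ x ∣ abs)
    where
    abs : ℤ.∣ a ∣ ≡ suc ℤ.∣ a ∣ ℕ.* ℤ.∣ x ∣
    abs = begin
      ℤ.∣ a ∣                       ≡⟨ cong ℤ.∣_∣ (inverseˡ-unique a (+ suc ℤ.∣ a ∣ * x) e) ⟩
      ℤ.∣ - (+ suc ℤ.∣ a ∣ * x) ∣    ≡⟨ ℤ.∣-i∣≡∣i∣ (+ suc ℤ.∣ a ∣ * x) ⟩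
      ℤ.∣ + suc ℤ.∣ a ∣ * x ∣        ≡⟨ ℤ.abs-* (+ suc ℤ.∣ a ∣) x ⟩
      suc ℤ.∣ a ∣ ℕ.* ℤ.∣ x ∣ ∎
    small : ∀ m y → m ≡ suc m ℕ.* y → m ≡ 0
    small m zero    e = trans e (ℕ.*-zeroʳ m)
    small m (suc y) e = contradiction (ℕ.m≤m*n (suc m) (suc y)) (ℕ.<-irrefl e)

  -- The choice t = |a| + 1 in `multiple-small` kills the constant term, and cancelling t passes the
  -- hypothesis on to the tail. Positive arguments suffice and can be cancelled.
  coeff-zero : ∀ p → (∀ n → eval p (+ suc n) ≡ + 0) → ∀ k → coeff p k ≡ + 0
  coeff-zero []      z k = refl
  coeff-zero (a ∷ p) z = λ { zero → a≡0 ; (suc k) → coeff-zero p tail≡0 k }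
    where
    a≡0 : a ≡ + 0
    a≡0 = multiple-small a (eval p (+ suc ℤ.∣ a ∣)) (z ℤ.∣ a ∣)
    tail≡0 : ∀ n → eval p (+ suc n) ≡ + 0
    tail≡0 n = ℤ.*-cancelˡ-≡ (+ suc n) _ (+ 0) (begin
      + suc n * eval p (+ suc n)         ≡⟨ ℤ.+-identityˡ _ ⟨
      + 0 + + suc n * eval p (+ suc n)   ≡⟨ cong (λ x → x + + suc n * eval p (+ suc n)) a≡0 ⟨
      a + + suc n * eval p (+ suc n)     ≡⟨ z n ⟩
      + 0                                ≡⟨ ℤ.*-zeroʳ (+ suc n) ⟨
      + suc n * + 0                        ∎)

  eval-diff : ∀ p q t → eval (p +P (- + 1) ·P q) t ≡ eval p t - eval q t
  eval-diff p q t = trans (eval-+P p _ t)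
    (cong (λ x → eval p t + x) (trans (eval-·P (- + 1) q t) (ℤ.-1*i≡-i (eval q t))))

  coeff-diff : ∀ p q k → coeff (p +P (- + 1) ·P q) k ≡ coeff p k - coeff q k
  coeff-diff p q k = trans (coeff-+P p _ k)
    (cong (λ x → coeff p k + x) (trans (coeff-·P (- + 1) q k) (ℤ.-1*i≡-i (coeff q k))))

  -- Coefficient lists may differ by trailing zeros, so the conclusion is coefficientwise.
  eval⇒coeffs : ∀ p q → (∀ t → eval p t ≡ eval q t) → ∀ k → coeff p k ≡ coeff q k
  eval⇒coeffs p q e k = ℤ.i-j≡0⇒i≡j _ _ (trans (sym (coeff-diff p q k))
    (coeff-zero (p +P (- + 1) ·P q) (λ n → trans (eval-diff p q (+ suc n)) (ℤ.i≡j⇒i-j≡0 (e (+ suc n)))) k))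

  term : ∀ {n} → (Fin (suc n) → Fin (suc n) → Poly) → Fin (suc n) → Poly
  term {n} M j = sign (toℕ j) ·P (M zero j *P det n (λ r c → M (suc r) (punchIn j c)))

  -- The where-function of det that sums the cofactors cannot be named outside Defs.
  -- Once the columns and suc k are abstracted in the second declaration, its four
  -- arguments are distinct variables, and unification finds it as the value of the underscore.
  mutual
    cofactorSum : ∀ n → (Fin (suc n) → Fin (suc n) → Poly) → ∀ k → (Fin k → Fin (suc n)) → Poly
    cofactorSum = _

    cofactorSum-tail : ∀ k (M : Fin (suc (suc k)) → Fin (suc (suc k)) → Poly) →
      det (suc (suc k)) M ≡ cofactorSum (suc k) M k (λ i → suc (suc i)) +P term M (suc zero) +P term M zero
    cofactorSum-tail k M with term M (suc zero) | term M zero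
    ... | a | b with (λ (i : Fin k) → Fin.suc (Fin.suc i))
    ... | f with suc k
    ... | n = refl

open Evaluation

-- Determinants over lists of indices

module Determinants where

  open import Data.Integer using (_+_; _*_; _-_)

  module _ {I : Set} where

    -- Interior product: expansion along a row with entries v, where φ is the
    -- determinant of the remaining rows as a function of the remaining columns.
    contr : (I → ℤ) → (List I → ℤ) → List I → ℤ
    contr v φ []       = + 0
    contr v φ (c ∷ cs) = v c * φ cs - contr v (φ ∘ (c ∷_)) cs

    -- Rows and columns are lists of indices into one fixed matrix, so deleting, permuting and
    -- repeating them are list operations.
    detL : (I → I → ℤ) → List I → List I → ℤ
    detL N []       []      = + 1
    detL N []       (_ ∷ _) = + 0
    detL N (r ∷ rs)         = contr (N r) (detL N rs)

  -- The first term is added last, the order in which `det` accumulates its cofactors.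
  sumF : ∀ k → (Fin k → ℤ) → ℤ
  sumF zero    g = + 0
  sumF (suc k) g = sumF k (g ∘ suc) + g zero

  sumF-cong : ∀ k {g h : Fin k → ℤ} → (∀ i → g i ≡ h i) → sumF k g ≡ sumF k h
  sumF-cong zero    e = refl
  sumF-cong (suc k) e = cong₂ _+_ (sumF-cong k (e ∘ suc)) (e zero)

  sumF-neg : ∀ k (g : Fin k → ℤ) → sumF k (λ i → - g i) ≡ - sumF k g
  sumF-neg zero    g = refl
  sumF-neg (suc k) g = trans (cong (_+ - g zero) (sumF-neg k (g ∘ suc))) (sym (ℤ.neg-distrib-+ (sumF k (g ∘ suc)) (g zero)))

  eval-cofactorSum : ∀ t n M k f → eval (cofactorSum n M k f) t ≡ sumF k (λ i → eval (term M (f i)) t)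
  eval-cofactorSum t n M zero    f = refl
  eval-cofactorSum t n M (suc k) f = trans (eval-+P (cofactorSum n M k (f ∘ suc)) (term M (f zero)) t)
                                  (cong (_+ eval (term M (f zero)) t) (eval-cofactorSum t n M k (f ∘ suc)))

  contr-tabulate : ∀ {I : Set} n (v : I → ℤ) (φ : List I → ℤ) (c : Fin (suc n) → I) →
    contr v φ (tabulate c) ≡ sumF (suc n) (λ j → sign (toℕ j) * (v (c j) * φ (tabulate (c ∘ punchIn j))))
  contr-tabulate zero    v φ c = lem (v (c zero)) (φ [])
    where
    lem : ∀ a b → a * b - + 0 ≡ + 0 + + 1 * (a * b)
    lem = solve-∀
  contr-tabulate (suc n) v φ c = begin
    a - contr v (φ ∘ (c zero ∷_)) (tabulate (c ∘ suc))
      ≡⟨ cong (λ x → a - x) (contr-tabulate n v (φ ∘ (c zero ∷_)) (c ∘ suc)) ⟩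
    a - sumF (suc n) g
      ≡⟨ lem a (sumF (suc n) g) ⟩
    - sumF (suc n) g + + 1 * a
      ≡⟨ cong (_+ + 1 * a) (sumF-neg (suc n) g) ⟨
    sumF (suc n) (λ j → - g j) + + 1 * a
      ≡⟨ cong (_+ + 1 * a) (sumF-cong (suc n) (λ j → ℤ.neg-distribˡ-* (sign (toℕ j)) (h j))) ⟩
    sumF (suc n) (λ j → - sign (toℕ j) * (v (c (suc j)) * φ (tabulate (c ∘ punchIn (suc j))))) + + 1 * a ∎
    where
    a = v (c zero) * φ (tabulate (c ∘ suc))
    h = λ j → v (c (suc j)) * φ (c zero ∷ tabulate (c ∘ suc ∘ punchIn j))
    g = λ j → sign (toℕ j) * h j
    lem : ∀ a b → a - b ≡ - b + + 1 * a
    lem = solve-∀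

  -- `r` and `c` record where the rows and columns of the current submatrix come from, so the
  -- induction over minors keeps a single `N`.
  eval-det : ∀ t {I : Set} (N : I → I → ℤ) n (M : Fin n → Fin n → Poly) (r c : Fin n → I) →
    (∀ i j → eval (M i j) t ≡ N (r i) (c j)) → eval (det n M) t ≡ detL N (tabulate r) (tabulate c)
  eval-det t N zero    M r c e = cong (λ x → + 1 + x) (ℤ.*-zeroʳ t)
  eval-det t N (suc n) M r c e = begin
    eval (det (suc n) M) t
      ≡⟨ eval-cofactorSum t n M (suc n) id ⟩
    sumF (suc n) (λ j → eval (term M j) t)
      ≡⟨ sumF-cong (suc n) (λ j → trans (eval-·P (sign (toℕ j)) (M zero j *P det n (minor j)) t)
           (cong (sign (toℕ j) *_) (trans (eval-*P (M zero j) (det n (minor j)) t) (cong₂ _*_ (e zero j)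
             (eval-det t N n (minor j) (r ∘ suc) (c ∘ punchIn j) (λ i k → e (suc i) (punchIn j k))))))) ⟩
    sumF (suc n) (λ j → sign (toℕ j) * (N (r zero) (c j) * detL N (tabulate (r ∘ suc)) (tabulate (c ∘ punchIn j))))
      ≡⟨ contr-tabulate n (N (r zero)) (detL N (tabulate (r ∘ suc))) c ⟨
    detL N (tabulate r) (tabulate c) ∎
    where
    minor : Fin (suc n) → Fin n → Fin n → Poly
    minor j i k = M (suc i) (punchIn j k)

  -- A relation between the indices, instead of a function, also covers the replacement of a single
  -- index by a copy of it.
  contr-resp : ∀ {I J : Set} {R : I → J → Set} {v : I → ℤ} {w : J → ℤ} {φ : List I → ℤ} {ψ : List J → ℤ} →
    (∀ {c d} → R c d → v c ≡ w d) → (∀ {cs ds} → Pointwise R cs ds → φ cs ≡ ψ ds) →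
    ∀ {cs ds} → Pointwise R cs ds → contr v φ cs ≡ contr w ψ ds
  contr-resp hv hφ []       = refl
  contr-resp hv hφ (x ∷ xs) = cong₂ _-_ (cong₂ _*_ (hv x) (hφ xs)) (contr-resp hv (λ ys → hφ (x ∷ ys)) xs)

  detL-resp : ∀ {I J : Set} {R : I → J → Set} {N : I → I → ℤ} {N′ : J → J → ℤ} {rs rs′} →
    Pointwise (λ r r′ → ∀ {c c′} → R c c′ → N r c ≡ N′ r′ c′) rs rs′ →
    ∀ {cs cs′} → Pointwise R cs cs′ → detL N rs cs ≡ detL N′ rs′ cs′
  detL-resp []       []      = refl
  detL-resp []       (_ ∷ _) = refl
  detL-resp (e ∷ es) xs      = contr-resp e (detL-resp es) xs

  module _ {I : Set} where

    contr-cong : ∀ (v : I → ℤ) {φ ψ : List I → ℤ} → (∀ cs → φ cs ≡ ψ cs) → ∀ cs → contr v φ cs ≡ contr v ψ cs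
    contr-cong v e []       = refl
    contr-cong v e (c ∷ cs) = cong₂ (λ x y → v c * x - y) (e cs) (contr-cong v (e ∘ (c ∷_)) cs)

    contr-linear : ∀ (v : I → ℤ) a φ b ψ cs →
      contr v (λ ds → a * φ ds + b * ψ ds) cs ≡ a * contr v φ cs + b * contr v ψ cs
    contr-linear v a φ b ψ []       = sym (cong₂ _+_ (ℤ.*-zeroʳ a) (ℤ.*-zeroʳ b))
    contr-linear v a φ b ψ (c ∷ cs) = begin
      v c * (a * φ cs + b * ψ cs) - contr v _ cs
        ≡⟨ cong (λ x → v c * (a * φ cs + b * ψ cs) - x) (contr-linear v a _ b _ cs) ⟩
      v c * (a * φ cs + b * ψ cs) - (a * x + b * y)
        ≡⟨ lem (v c) a (φ cs) b (ψ cs) x y ⟩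
      a * (v c * φ cs - x) + b * (v c * ψ cs - y) ∎
      where
      x = contr v (φ ∘ (c ∷_)) cs
      y = contr v (ψ ∘ (c ∷_)) cs
      lem : ∀ v a p b q x y → v * (a * p + b * q) - (a * x + b * y) ≡ a * (v * p - x) + b * (v * q - y)
      lem = solve-∀

    contr-neg : ∀ (v : I → ℤ) {φ ψ : List I → ℤ} → (∀ ds → φ ds ≡ - ψ ds) → ∀ cs → contr v φ cs ≡ - contr v ψ cs
    contr-neg v {φ} {ψ} e cs = begin
      contr v φ cs
        ≡⟨ contr-cong v (λ ds → trans (e ds) (lem (ψ ds))) cs ⟩
      contr v (λ ds → - + 1 * ψ ds + + 0 * ψ ds) cs
        ≡⟨ contr-linear v (- + 1) ψ (+ 0) ψ cs ⟩
      - + 1 * contr v ψ cs + + 0 * contr v ψ cs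
        ≡⟨ lem (contr v ψ cs) ⟨
      - contr v ψ cs ∎
      where
      lem : ∀ x → - x ≡ - + 1 * x + + 0 * x
      lem = solve-∀

    -- The terms that use the first column agree up to sign, and the rest is the induction
    -- hypothesis. This is the exchange of two adjacent rows.
    contr-anticomm : ∀ (v w : I → ℤ) φ cs → contr v (contr w φ) cs ≡ - contr w (contr v φ) cs
    contr-anticomm v w φ []       = refl
    contr-anticomm v w φ (c ∷ cs) = begin
      v c * contr w φ cs - contr v (λ ds → w c * φ ds - contr w φc ds) cs
        ≡⟨ cong (λ x → v c * contr w φ cs - x) (expand v w) ⟩
      v c * contr w φ cs - (w c * contr v φ cs - contr v (contr w φc) cs)
        ≡⟨ cong (λ x → v c * contr w φ cs - (w c * contr v φ cs - x)) (contr-anticomm v w φc cs) ⟩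
      v c * contr w φ cs - (w c * contr v φ cs - - contr w (contr v φc) cs)
        ≡⟨ lem (v c * contr w φ cs) (w c * contr v φ cs) (contr w (contr v φc) cs) ⟩
      - (w c * contr v φ cs - (v c * contr w φ cs - contr w (contr v φc) cs))
        ≡⟨ cong (λ x → - (w c * contr v φ cs - x)) (expand w v) ⟨
      - (w c * contr v φ cs - contr w (λ ds → v c * φ ds - contr v φc ds) cs) ∎
      where
      φc = φ ∘ (c ∷_)
      lem₁ : ∀ a b → a - b ≡ a + - + 1 * b
      lem₁ = solve-∀
      expand : ∀ v w → contr v (λ ds → w c * φ ds - contr w φc ds) cs ≡ w c * contr v φ cs - contr v (contr w φc) cs
      expand v w = begin
        contr v (λ ds → w c * φ ds - contr w φc ds) cs
          ≡⟨ contr-cong v (λ ds → lem₁ (w c * φ ds) (contr w φc ds)) cs ⟩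
        contr v (λ ds → w c * φ ds + - + 1 * contr w φc ds) cs
          ≡⟨ contr-linear v (w c) φ (- + 1) (contr w φc) cs ⟩
        w c * contr v φ cs + - + 1 * contr v (contr w φc) cs
          ≡⟨ lem₁ (w c * contr v φ cs) (contr v (contr w φc) cs) ⟨
        w c * contr v φ cs - contr v (contr w φc) cs ∎
      lem : ∀ a b z → a - (b - - z) ≡ - (b - (a - z))
      lem = solve-∀

    Symmetric : (List I → ℤ) → Set
    Symmetric D = ∀ pre a b post → D (pre ++ a ∷ b ∷ post) ≡ D (pre ++ b ∷ a ∷ post)

    Antisymmetric : (List I → ℤ) → Set
    Antisymmetric φ = ∀ pre a b post → φ (pre ++ a ∷ b ∷ post) ≡ - φ (pre ++ b ∷ a ∷ post)

    contr-antisym : ∀ (v : I → ℤ) {φ} → Antisymmetric φ → Antisymmetric (contr v φ)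
    contr-antisym v {φ} anti []        a b post = begin
      v a * φ (b ∷ post) - (v b * φ (a ∷ post) - contr v (φ ∘ (a ∷_) ∘ (b ∷_)) post)
        ≡⟨ cong (λ x → v a * φ (b ∷ post) - (v b * φ (a ∷ post) - x)) (contr-neg v (anti [] a b) post) ⟩
      v a * φ (b ∷ post) - (v b * φ (a ∷ post) - - contr v (φ ∘ (b ∷_) ∘ (a ∷_)) post)
        ≡⟨ lem (v a * φ (b ∷ post)) (v b * φ (a ∷ post)) _ ⟩
      - (v b * φ (a ∷ post) - (v a * φ (b ∷ post) - contr v (φ ∘ (b ∷_) ∘ (a ∷_)) post)) ∎
      where
      lem : ∀ a b z → a - (b - - z) ≡ - (b - (a - z))
      lem = solve-∀
    contr-antisym v {φ} anti (c ∷ pre) a b post = begin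
      v c * φ (pre ++ a ∷ b ∷ post) - contr v (φ ∘ (c ∷_)) (pre ++ a ∷ b ∷ post)
        ≡⟨ cong₂ (λ x y → v c * x - y) (anti pre a b post) (contr-antisym v (λ pre → anti (c ∷ pre)) pre a b post) ⟩
      v c * - φ (pre ++ b ∷ a ∷ post) - - contr v (φ ∘ (c ∷_)) (pre ++ b ∷ a ∷ post)
        ≡⟨ lem (v c) (φ (pre ++ b ∷ a ∷ post)) _ ⟩
      - (v c * φ (pre ++ b ∷ a ∷ post) - contr v (φ ∘ (c ∷_)) (pre ++ b ∷ a ∷ post)) ∎
      where
      lem : ∀ v x y → v * - x - - y ≡ - (v * x - y)
      lem = solve-∀

    detL-colSwap : ∀ N rs → Antisymmetric (detL N rs)
    detL-colSwap N []       []      a b post = refl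
    detL-colSwap N []       (_ ∷ _) a b post = refl
    detL-colSwap N (r ∷ rs)                  = contr-antisym (N r) (detL-colSwap N rs)

    detL-rowSwap : ∀ N pre r s post cs → detL N (pre ++ r ∷ s ∷ post) cs ≡ - detL N (pre ++ s ∷ r ∷ post) cs
    detL-rowSwap N []        r s post cs = contr-anticomm (N r) (N s) (detL N post) cs
    detL-rowSwap N (p ∷ pre) r s post cs = contr-neg (N p) (detL-rowSwap N pre r s post) cs

    principal : (I → I → ℤ) → List I → ℤ
    principal N is = detL N is is

    -- One exchange of rows and one of columns: the signs cancel.
    principal-symmetric : ∀ N → Symmetric (principal N)
    principal-symmetric N pre a b post = begin
      detL N (pre ++ a ∷ b ∷ post) (pre ++ a ∷ b ∷ post)     ≡⟨ detL-rowSwap N pre a b post _ ⟩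
      - detL N (pre ++ b ∷ a ∷ post) (pre ++ a ∷ b ∷ post)   ≡⟨ cong -_ (detL-colSwap N (pre ++ b ∷ a ∷ post) pre a b post) ⟩
      - - detL N (pre ++ b ∷ a ∷ post) (pre ++ b ∷ a ∷ post) ≡⟨ ℤ.neg-involutive _ ⟩
      detL N (pre ++ b ∷ a ∷ post) (pre ++ b ∷ a ∷ post) ∎

    x≡-x⇒x≡0 : ∀ x → x ≡ - x → x ≡ + 0
    x≡-x⇒x≡0 (+ zero)   _ = refl
    x≡-x⇒x≡0 (+ suc n)  ()
    x≡-x⇒x≡0 (-[1+ n ]) ()

    VanishesOnRepeats : (List I → ℤ) → Set
    VanishesOnRepeats D = ∀ pre a post → D (pre ++ a ∷ a ∷ post) ≡ + 0

    -- Exchanging the two equal rows shows that the minor is its own negative.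
    principal-vanishes : ∀ N → VanishesOnRepeats (principal N)
    principal-vanishes N pre a post = x≡-x⇒x≡0 _ (detL-rowSwap N pre a a post _)

    symmetric-↭ : ∀ (D : List I → ℤ) → Symmetric D → ∀ {xs ys} → xs ↭ ys → D xs ≡ D ys
    symmetric-↭ D s Perm.refl         = refl
    symmetric-↭ D s (Perm.prep x p)   = symmetric-↭ (D ∘ (x ∷_)) (λ pre → s (x ∷ pre)) p
    symmetric-↭ D s (Perm.swap x y p) = trans (s [] x y _) (symmetric-↭ (D ∘ (y ∷_) ∘ (x ∷_)) (λ pre → s (y ∷ x ∷ pre)) p)
    symmetric-↭ D s (Perm.trans p q)  = trans (symmetric-↭ D s p) (symmetric-↭ D s q)

open Determinants

-- Coefficients of the characteristic polynomial as sums of principal minors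

module PrincipalMinors where

  open import Data.Integer using (_+_; _*_; _-_)

  sumSublists : ∀ {I : Set} → List I → ℕ → (List I → ℤ) → ℤ
  sumSublists xs       zero    D = D []
  sumSublists []       (suc k) D = + 0
  sumSublists (x ∷ xs) (suc k) D = sumSublists xs (suc k) D + sumSublists xs k (D ∘ (x ∷_))

  sumSublists-cong : ∀ {I : Set} (xs : List I) k {D E : List I → ℤ} → (∀ s → D s ≡ E s) → sumSublists xs k D ≡ sumSublists xs k E
  sumSublists-cong xs       zero    e = e []
  sumSublists-cong []       (suc k) e = refl
  sumSublists-cong (x ∷ xs) (suc k) e = cong₂ _+_ (sumSublists-cong xs (suc k) e) (sumSublists-cong xs k (e ∘ (x ∷_)))

  sumSublists-large : ∀ {I : Set} (xs : List I) k (D : List I → ℤ) → length xs ℕ.< k → sumSublists xs k D ≡ + 0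
  sumSublists-large []       (suc k) D _         = refl
  sumSublists-large (x ∷ xs) (suc k) D (ℕ.s≤s l) = cong₂ _+_ (sumSublists-large xs (suc k) D (ℕ.m≤n⇒m≤1+n l)) (sumSublists-large xs k _ l)

  module Expansion {n : ℕ} (M : Fin n → Fin n → ℤ) where

    -- The indices inj₁ i carry the variable t on the diagonal, the indices inj₂ i do not.
    shifted : ℤ → Fin n ⊎ Fin n → Fin n ⊎ Fin n → ℤ
    shifted t (inj₁ i) (inj₁ j) = (if ⌊ i ≟ j ⌋ then t else + 0) + M i j
    shifted t (inj₁ i) (inj₂ j) = M i j
    shifted t (inj₂ i) (inj₁ j) = M i j
    shifted t (inj₂ i) (inj₂ j) = M i j

    -- Interpolates between det(t + M), when all indices are in `xs`, and a principal minor of `M`,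
    -- when all are frozen in `s`.
    partial : ℤ → List (Fin n) → List (Fin n) → ℤ
    partial t xs s = principal (shifted t) (map inj₂ s ++ map inj₁ xs)

    shifted-diag : ∀ t i → shifted t (inj₁ i) (inj₁ i) ≡ t + M i i
    shifted-diag t i with i ≟ i
    ... | yes _  = refl
    ... | no i≢i = contradiction refl i≢i

    shifted-off : ∀ t {i j} → i ≢ j → shifted t (inj₁ i) (inj₁ j) ≡ M i j
    shifted-off t {i} {j} i≢j with i ≟ j
    ... | yes i≡j = contradiction i≡j i≢j
    ... | no _    = ℤ.+-identityˡ _

    diagonal : ∀ {A : Set} {P : A → Set} {xs} → All P xs → Pointwise (λ a b → a ≡ b × P a) xs xs
    diagonal []       = []
    diagonal (p ∷ ps) = (refl , p) ∷ diagonal ps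

    -- The determinant is affine in the diagonal entry at `x`: the coefficient of `t` is the minor
    -- without `x`, and the remainder is the determinant with `x` frozen.
    partial-step : ∀ t x xs s → All (x ≢_) xs →
      partial t (x ∷ xs) s ≡ t * partial t xs s + partial t xs (x ∷ s)
    partial-step t x xs s x∉xs = begin
      partial t (x ∷ xs) s
        ≡⟨ symmetric-↭ (principal N) (principal-symmetric N) (shift (inj₁ x) (map inj₂ s) (map inj₁ xs)) ⟩
      N (inj₁ x) (inj₁ x) * detL N K K - contr (N (inj₁ x)) (detL N K ∘ (inj₁ x ∷_)) K
        ≡⟨ cong₂ (λ a b → a * detL N K K - b) (shifted-diag t x) freeze ⟩
      (t + M x x) * detL N K K - contr (N (inj₂ x)) (detL N K ∘ (inj₂ x ∷_)) K
        ≡⟨ lem t (M x x) (detL N K K) _ ⟩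
      t * detL N K K + (M x x * detL N K K - contr (N (inj₂ x)) (detL N K ∘ (inj₂ x ∷_)) K) ∎
      where
      N = shifted t
      K = map inj₂ s ++ map inj₁ xs
      lem : ∀ t m p c → (t + m) * p - c ≡ t * p + (m * p - c)
      lem = solve-∀
      row : All (λ k → N (inj₁ x) k ≡ N (inj₂ x) k) K
      row = All.++⁺ (All.map⁺ (All.universal (λ _ → refl) s)) (All.map⁺ (All.map (λ x≢y → shifted-off t x≢y) x∉xs))
      column : All (λ k → N k (inj₁ x) ≡ N k (inj₂ x)) K
      column = All.++⁺ (All.map⁺ (All.universal (λ _ → refl) s)) (All.map⁺ (All.map (λ x≢y → shifted-off t (x≢y ∘ sym)) x∉xs))
      R : Fin n ⊎ Fin n → Fin n ⊎ Fin n → Set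
      R c d = c ≡ d ⊎ (c ≡ inj₁ x × d ≡ inj₂ x)
      rows : Pointwise (λ r r′ → ∀ {c d} → R c d → N r c ≡ N r′ d) K K
      rows = PW.map (λ { (refl , e) (inj₁ refl) → refl ; (refl , e) (inj₂ (refl , refl)) → e }) (diagonal column)
      -- Off the diagonal `inj₁ x` and `inj₂ x` have the same entries, because `x` does not occur in
      -- `xs`.
      freeze : contr (N (inj₁ x)) (detL N K ∘ (inj₁ x ∷_)) K ≡ contr (N (inj₂ x)) (detL N K ∘ (inj₂ x ∷_)) K
      freeze = contr-resp (λ { (refl , e) → e })
        (λ ps → detL-resp rows (inj₂ (refl , refl) ∷ PW.map (inj₁ ∘ proj₁) ps)) (diagonal row)

    partial-base : ∀ t s → partial t [] s ≡ principal M s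
    partial-base t s = detL-resp (PW.map (λ { refl refl → refl }) (frozen s)) (frozen s)
      where
      frozen : ∀ s → Pointwise (λ c d → c ≡ inj₂ d) (map inj₂ s ++ []) s
      frozen []      = []
      frozen (_ ∷ s) = refl ∷ frozen s

    -- The recursion of `partial-step`, read as one for polynomials in t.
    Q : List (Fin n) → List (Fin n) → Poly
    Q []       s = principal M s ∷ []
    Q (x ∷ xs) s = (+ 0 ∷ Q xs s) +P Q xs (x ∷ s)

    eval-Q : ∀ t {xs} s → Unique xs → eval (Q xs s) t ≡ partial t xs s
    eval-Q t {[]}     s []             = begin
      principal M s + t * + 0   ≡⟨ cong (λ x → principal M s + x) (ℤ.*-zeroʳ t) ⟩
      principal M s + + 0       ≡⟨ ℤ.+-identityʳ _ ⟩
      principal M s             ≡⟨ partial-base t s ⟨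
      partial t [] s            ∎
    eval-Q t {x ∷ xs} s (x∉xs ∷ u) = begin
      eval ((+ 0 ∷ Q xs s) +P Q xs (x ∷ s)) t
        ≡⟨ eval-+P (+ 0 ∷ Q xs s) (Q xs (x ∷ s)) t ⟩
      + 0 + t * eval (Q xs s) t + eval (Q xs (x ∷ s)) t
        ≡⟨ cong₂ _+_ (trans (ℤ.+-identityˡ _) (cong (t *_) (eval-Q t s u))) (eval-Q t (x ∷ s) u) ⟩
      t * partial t xs s + partial t xs (x ∷ s)
        ≡⟨ partial-step t x xs s x∉xs ⟨
      partial t (x ∷ xs) s ∎

    Q-degree : ∀ xs s j → length xs ℕ.< j → coeff (Q xs s) j ≡ + 0
    Q-degree []       s (suc j) _         = refl
    Q-degree (x ∷ xs) s (suc j) (ℕ.s≤s l) = trans (coeff-+P (+ 0 ∷ Q xs s) (Q xs (x ∷ s)) (suc j))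
      (cong₂ _+_ (Q-degree xs s j l) (Q-degree xs (x ∷ s) (suc j) (ℕ.m≤n⇒m≤1+n l)))

    -- Each index either contributes a factor t or is frozen, so degree j leaves k frozen ones. They
    -- accumulate in reverse, hence `ʳ++`.
    coeff-Q : ∀ xs s j k → j ℕ.+ k ≡ length xs → coeff (Q xs s) j ≡ sumSublists xs k (λ τ → principal M (τ ʳ++ s))
    coeff-Q []       s zero    zero    e = refl
    coeff-Q (x ∷ xs) s zero    (suc k) e = trans (coeff-+P (+ 0 ∷ Q xs s) (Q xs (x ∷ s)) 0)
      (cong₂ _+_ (sym (sumSublists-large xs (suc k) _ (ℕ.≤-reflexive (sym e))))
                 (coeff-Q xs (x ∷ s) zero k (ℕ.suc-injective e)))
    coeff-Q (x ∷ xs) s (suc j) zero    e = trans (coeff-+P (+ 0 ∷ Q xs s) (Q xs (x ∷ s)) (suc j))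
      (trans (cong₂ _+_ (coeff-Q xs s j zero (ℕ.suc-injective e))
                        (Q-degree xs (x ∷ s) (suc j) (ℕ.≤-reflexive (trans (sym e) (ℕ.+-identityʳ (suc j))))))
             (ℤ.+-identityʳ _))
    coeff-Q (x ∷ xs) s (suc j) (suc k) e = trans (coeff-+P (+ 0 ∷ Q xs s) (Q xs (x ∷ s)) (suc j))
      (cong₂ _+_ (coeff-Q xs s j (suc k) (ℕ.suc-injective e))
                 (coeff-Q xs (x ∷ s) (suc j) k (trans (sym (ℕ.+-suc j k)) (ℕ.suc-injective e))))

  entry : Bool → ℤ
  entry b = if b then - + 1 else + 0

  negAdj : ∀ {n} → Graph n → Fin n → Fin n → ℤ
  negAdj G i j = entry (adj G i j)

  minors : ∀ {n} → Graph n → ℕ → ℤ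
  minors {n} G k = sumSublists (allFin n) k (principal (negAdj G))

  module _ {n} (G : Graph n) where
    open Expansion (negAdj G)

    eval-charPoly : ∀ t → eval (charPoly G) t ≡ eval (Q (allFin n) []) t
    eval-charPoly t = begin
      eval (charPoly G) t
        ≡⟨ eval-det t (shifted t) n _ inj₁ inj₁ entries ⟩
      principal (shifted t) (tabulate inj₁)
        ≡⟨ cong (principal (shifted t)) (map-tabulate id inj₁) ⟨
      partial t (allFin n) []
        ≡⟨ eval-Q t [] (allFin⁺ n) ⟨
      eval (Q (allFin n) []) t ∎
      where
      lem : ∀ t → + 0 + t * (+ 1 + t * + 0) ≡ t + + 0
      lem = solve-∀
      entries : ∀ i j → eval (if ⌊ i ≟ j ⌋ then (+ 0 ∷ + 1 ∷ []) else (if adj G i j then (- + 1 ∷ []) else [])) t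
                        ≡ shifted t (inj₁ i) (inj₁ j)
      entries i j with i ≟ j
      entries i .i | yes refl rewrite irrefl G i = lem t
      entries i j  | no _ with adj G i j
      ... | true  = cong (λ x → - + 1 + x) (ℤ.*-zeroʳ t)
      ... | false = refl

    coeff-charPoly : ∀ j → coeff (charPoly G) j ≡ coeff (Q (allFin n) []) j
    coeff-charPoly = eval⇒coeffs (charPoly G) (Q (allFin n) []) eval-charPoly

    coeff-minors : ∀ j k → j ℕ.+ k ≡ n → coeff (charPoly G) j ≡ minors G k
    coeff-minors j k e = begin
      coeff (charPoly G) j
        ≡⟨ coeff-charPoly j ⟩
      coeff (Q (allFin n) []) j
        ≡⟨ coeff-Q (allFin n) [] j k (trans e (sym (length-tabulate id))) ⟩
      sumSublists (allFin n) k (λ τ → principal (negAdj G) (τ ʳ++ []))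
        ≡⟨ sumSublists-cong (allFin n) k (λ τ → symmetric-↭ (principal (negAdj G)) (principal-symmetric (negAdj G)) (↭-reverse τ)) ⟩
      minors G k ∎

    coeff-large : ∀ j → n ℕ.< j → coeff (charPoly G) j ≡ + 0
    coeff-large j l = trans (coeff-charPoly j)
      (Q-degree (allFin n) [] j (subst (ℕ._< j) (sym (length-tabulate id)) l))

    minors-large : ∀ k → n ℕ.< k → minors G k ≡ + 0
    minors-large k l = sumSublists-large (allFin n) k _ (subst (ℕ._< k) (sym (length-tabulate id)) l)

  cospectral⇒minors : ∀ {n m} {G : Graph n} {H : Graph m} → Cospectral G H → ∀ k → minors G k ≡ minors H k
  cospectral⇒minors {n} {G = G} {H} (refl , e) k with k ℕ.≤? n
  ... | yes k≤n = trans (sym (coeff-minors G (n ℕ.∸ k) k (ℕ.m∸n+n≡m k≤n)))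
                    (trans (e (n ℕ.∸ k)) (coeff-minors H (n ℕ.∸ k) k (ℕ.m∸n+n≡m k≤n)))
  ... | no k≰n = trans (minors-large G k (ℕ.≰⇒> k≰n)) (sym (minors-large H k (ℕ.≰⇒> k≰n)))

  minors⇒cospectral : ∀ {n m} {G : Graph n} {H : Graph m} → n ≡ m → (∀ k → minors G k ≡ minors H k) → Cospectral G H
  minors⇒cospectral {n} {G = G} {H} refl e = refl , coeffs
    where
    coeffs : ∀ j → coeff (charPoly G) j ≡ coeff (charPoly H) j
    coeffs j with j ℕ.≤? n
    ... | yes j≤n = trans (coeff-minors G j (n ℕ.∸ j) (ℕ.m+[n∸m]≡n j≤n))
                      (trans (e (n ℕ.∸ j)) (sym (coeff-minors H j (n ℕ.∸ j) (ℕ.m+[n∸m]≡n j≤n))))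
    ... | no j≰n = trans (coeff-large G j (ℕ.≰⇒> j≰n)) (sym (coeff-large H j (ℕ.≰⇒> j≰n)))

open PrincipalMinors

-- Minor sums of blow-ups

module BlowUps where

  open import Data.Integer using (_+_; _*_; _-_)

  sumL : ∀ {A : Set} → List A → (A → ℤ) → ℤ
  sumL []       f = + 0
  sumL (x ∷ xs) f = f x + sumL xs f

  sumL-cong : ∀ {A : Set} (xs : List A) {f g : A → ℤ} → (∀ x → f x ≡ g x) → sumL xs f ≡ sumL xs g
  sumL-cong []       e = refl
  sumL-cong (x ∷ xs) e = cong₂ _+_ (e x) (sumL-cong xs e)

  sumL-zero : ∀ {A : Set} (xs : List A) {f : A → ℤ} → (∀ x → f x ≡ + 0) → sumL xs f ≡ + 0
  sumL-zero []       z = refl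
  sumL-zero (x ∷ xs) z = cong₂ _+_ (z x) (sumL-zero xs z)

  sumL-linear : ∀ {A : Set} (xs : List A) (f : A → ℤ) a g → sumL xs (λ x → f x + a * g x) ≡ sumL xs f + a * sumL xs g
  sumL-linear []       f a g = sym (trans (ℤ.+-identityˡ _) (ℤ.*-zeroʳ a))
  sumL-linear (x ∷ xs) f a g =
    trans (cong (λ s → f x + a * g x + s) (sumL-linear xs f a g)) (lem (f x) a (g x) (sumL xs f) (sumL xs g))
    where
    lem : ∀ p a q r s → p + a * q + (r + a * s) ≡ p + r + a * (q + s)
    lem = solve-∀

  sumL-scale : ∀ {A : Set} (xs : List A) a (g : A → ℤ) → sumL xs (λ x → a * g x) ≡ a * sumL xs g
  sumL-scale []       a g = sym (ℤ.*-zeroʳ a)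
  sumL-scale (x ∷ xs) a g = trans (cong (λ s → a * g x + s) (sumL-scale xs a g)) (sym (ℤ.*-distribˡ-+ a (g x) _))

  sumL-tabulate : ∀ {A : Set} n (g : Fin n → A) f → sumL (tabulate g) f ≡ sumL (allFin n) (f ∘ g)
  sumL-tabulate zero    g f = refl
  sumL-tabulate (suc n) g f = cong (λ x → f (g zero) + x)
    (trans (sumL-tabulate n (g ∘ suc) f) (sym (sumL-tabulate n suc (f ∘ g))))

  module _ {I : Set} where

    -- Tuples are ordered and may repeat. Unlike sums over sublists, these sums split along the
    -- fibres of a map.
    sumTuples : List I → ℕ → (List I → ℤ) → ℤ
    sumTuples xs zero    D = D []
    sumTuples xs (suc k) D = sumL xs (λ x → sumTuples xs k (D ∘ (x ∷_)))

    sumTuples-cong : ∀ (xs : List I) k {D E : List I → ℤ} → (∀ s → D s ≡ E s) → sumTuples xs k D ≡ sumTuples xs k E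
    sumTuples-cong xs zero    e = e []
    sumTuples-cong xs (suc k) e = sumL-cong xs (λ x → sumTuples-cong xs k (e ∘ (x ∷_)))

    sumTuples-zero : ∀ (xs : List I) k {D : List I → ℤ} → (∀ s → D s ≡ + 0) → sumTuples xs k D ≡ + 0
    sumTuples-zero xs zero    z = z []
    sumTuples-zero xs (suc k) z = sumL-zero xs (λ x → sumTuples-zero xs k (z ∘ (x ∷_)))

    sumTuples-scale : ∀ (xs : List I) k a (D : List I → ℤ) → sumTuples xs k (λ s → a * D s) ≡ a * sumTuples xs k D
    sumTuples-scale xs zero    a D = refl
    sumTuples-scale xs (suc k) a D = trans (sumL-cong xs (λ x → sumTuples-scale xs k a (D ∘ (x ∷_)))) (sumL-scale xs a _)

    -- A tuple that contains `x` once has it in one of k + 1 places, all equivalent by symmetry;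
    -- tuples that contain it more often contribute nothing.
    sumTuples-∷ : ∀ x xs k (D : List I → ℤ) → Symmetric D → VanishesOnRepeats D →
      sumTuples (x ∷ xs) (suc k) D ≡ sumTuples xs (suc k) D + + suc k * sumTuples xs k (D ∘ (x ∷_))
    sumTuples-∷ x xs zero    D s v = lem (D (x ∷ [])) _
      where
      lem : ∀ a b → a + b ≡ b + + 1 * a
      lem = solve-∀
    sumTuples-∷ x xs (suc k) D s v = begin
      sumTuples (x ∷ xs) (suc k) Dx + sumL xs (λ y → sumTuples (x ∷ xs) (suc k) (D ∘ (y ∷_)))
        ≡⟨ cong₂ _+_ (sumTuples-∷ x xs k Dx (s ∘ (x ∷_)) (v ∘ (x ∷_)))
                     (sumL-cong xs (λ y → sumTuples-∷ x xs k (D ∘ (y ∷_)) (s ∘ (y ∷_)) (v ∘ (y ∷_)))) ⟩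
      sumTuples xs (suc k) Dx + + suc k * sumTuples xs k (Dx ∘ (x ∷_))
        + sumL xs (λ y → sumTuples xs (suc k) (D ∘ (y ∷_)) + + suc k * sumTuples xs k (D ∘ (y ∷_) ∘ (x ∷_)))
        ≡⟨ cong₂ (λ a b → sumTuples xs (suc k) Dx + + suc k * a + b) (sumTuples-zero xs k (v [] x))
                 (trans (sumL-linear xs (λ y → sumTuples xs (suc k) (D ∘ (y ∷_))) (+ suc k) _)
                        (cong (λ a → sumTuples xs (suc (suc k)) D + + suc k * a)
                              (sumL-cong xs (λ y → sumTuples-cong xs k (s [] y x))))) ⟩
      sumTuples xs (suc k) Dx + + suc k * + 0 + (sumTuples xs (suc (suc k)) D + + suc k * sumTuples xs (suc k) Dx)
        ≡⟨ lem (+ suc k) (sumTuples xs (suc k) Dx) (sumTuples xs (suc (suc k)) D) ⟩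
      sumTuples xs (suc (suc k)) D + + suc (suc k) * sumTuples xs (suc k) Dx ∎
      where
      Dx = D ∘ (x ∷_)
      lem : ∀ k a b → a + k * + 0 + (b + k * a) ≡ b + (+ 1 + k) * a
      lem = solve-∀

    sumTuples≡sumSublists : ∀ xs k (D : List I → ℤ) → Symmetric D → VanishesOnRepeats D → sumTuples xs k D ≡ + (k !) * sumSublists xs k D
    sumTuples≡sumSublists xs       zero    D s v = sym (ℤ.*-identityˡ (D []))
    sumTuples≡sumSublists []       (suc k) D s v = sym (ℤ.*-zeroʳ (+ (suc k !)))
    sumTuples≡sumSublists (x ∷ xs) (suc k) D s v = begin
      sumTuples (x ∷ xs) (suc k) D
        ≡⟨ sumTuples-∷ x xs k D s v ⟩
      sumTuples xs (suc k) D + + suc k * sumTuples xs k Dx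
        ≡⟨ cong₂ (λ a b → a + + suc k * b) (sumTuples≡sumSublists xs (suc k) D s v) (sumTuples≡sumSublists xs k Dx (s ∘ (x ∷_)) (v ∘ (x ∷_))) ⟩
      + (suc k !) * sumSublists xs (suc k) D + + suc k * (+ (k !) * sumSublists xs k Dx)
        ≡⟨ cong (λ f → f * sumSublists xs (suc k) D + + suc k * (+ (k !) * sumSublists xs k Dx)) (ℤ.pos-* (suc k) (k !)) ⟩
      + suc k * + (k !) * sumSublists xs (suc k) D + + suc k * (+ (k !) * sumSublists xs k Dx)
        ≡⟨ lem (+ suc k) (+ (k !)) (sumSublists xs (suc k) D) (sumSublists xs k Dx) ⟩
      + suc k * + (k !) * (sumSublists xs (suc k) D + sumSublists xs k Dx)
        ≡⟨ cong (_* (sumSublists xs (suc k) D + sumSublists xs k Dx)) (ℤ.pos-* (suc k) (k !)) ⟨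
      + (suc k !) * sumSublists (x ∷ xs) (suc k) D ∎
      where
      Dx = D ∘ (x ∷_)
      lem : ∀ a f p q → a * f * p + a * (f * q) ≡ a * f * (p + q)
      lem = solve-∀

  δ : ∀ {m} → Fin m → Fin m → ℕ
  δ c d = if does (c ≟ d) then 1 else 0

  count : ∀ {n m} → (Fin n → Fin m) → Fin m → ℕ
  count {zero}  cl c = 0
  count {suc n} cl c = δ (cl zero) c ℕ.+ count (cl ∘ suc) c

  sum-δ : ∀ {m} (c : Fin m) (f : Fin m → ℤ) → sumL (allFin m) (λ d → + δ c d * f d) ≡ f c
  sum-δ {suc m} zero    f = begin
    + 1 * f zero + sumL (tabulate suc) (λ d → + δ zero d * f d)
      ≡⟨ cong (λ x → + 1 * f zero + x) (trans (sumL-tabulate m suc _) (sumL-zero (allFin m) (λ _ → refl))) ⟩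
    + 1 * f zero + + 0
      ≡⟨ trans (ℤ.+-identityʳ _) (ℤ.*-identityˡ _) ⟩
    f zero ∎
  sum-δ {suc m} (suc c) f = begin
    + 0 + sumL (tabulate suc) (λ d → + δ (suc c) d * f d)
      ≡⟨ trans (ℤ.+-identityˡ _) (sumL-tabulate m suc _) ⟩
    sumL (allFin m) (λ d → + δ c d * f (suc d))
      ≡⟨ sum-δ c (f ∘ suc) ⟩
    f (suc c) ∎

  sum-fibres : ∀ {n m} (cl : Fin n → Fin m) (f : Fin m → ℤ) → sumL (allFin n) (f ∘ cl) ≡ sumL (allFin m) (λ c → + count cl c * f c)
  sum-fibres {zero}  {m} cl f = sym (sumL-zero (allFin m) (λ _ → refl))
  sum-fibres {suc n} {m} cl f = begin
    f (cl zero) + sumL (tabulate suc) (f ∘ cl)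
      ≡⟨ cong₂ _+_ (sym (sum-δ (cl zero) f)) (trans (sumL-tabulate n suc _) (sum-fibres (cl ∘ suc) f)) ⟩
    sumL (allFin m) (λ c → + δ (cl zero) c * f c) + sumL (allFin m) (λ c → + count (cl ∘ suc) c * f c)
      ≡⟨ trans (sumL-linear (allFin m) _ (+ 1) _) (cong (λ x → sumL (allFin m) (λ c → + δ (cl zero) c * f c) + x) (ℤ.*-identityˡ _)) ⟨
    sumL (allFin m) (λ c → + δ (cl zero) c * f c + + 1 * (+ count (cl ∘ suc) c * f c))
      ≡⟨ sumL-cong (allFin m) (λ c → trans (lem (+ δ (cl zero) c) (+ count (cl ∘ suc) c) (f c))
           (cong (_* f c) (sym (ℤ.pos-+ (δ (cl zero) c) (count (cl ∘ suc) c))))) ⟩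
    sumL (allFin m) (λ c → + count cl c * f c) ∎
    where
    lem : ∀ a b x → a * x + + 1 * (b * x) ≡ (a + b) * x
    lem = solve-∀

  module _ {m} (w : Fin m → ℤ) where

    weight : List (Fin m) → ℤ
    weight []      = + 1
    weight (c ∷ s) = w c * weight s

    weighted : (List (Fin m) → ℤ) → List (Fin m) → ℤ
    weighted D s = weight s * D s

    weight-symmetric : Symmetric weight
    weight-symmetric []        a b post = lem (w a) (w b) (weight post)
      where
      lem : ∀ x y z → x * (y * z) ≡ y * (x * z)
      lem = solve-∀
    weight-symmetric (c ∷ pre) a b post = cong (w c *_) (weight-symmetric pre a b post)

    weighted-symmetric : ∀ D → Symmetric D → Symmetric (weighted D)
    weighted-symmetric D s pre a b post = cong₂ _*_ (weight-symmetric pre a b post) (s pre a b post)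

    weighted-vanishes : ∀ D → VanishesOnRepeats D → VanishesOnRepeats (weighted D)
    weighted-vanishes D v pre a post = trans (cong (weight (pre ++ a ∷ a ∷ post) *_) (v pre a post)) (ℤ.*-zeroʳ (weight (pre ++ a ∷ a ∷ post)))

  sumTuples-blowup : ∀ {n m} (cl : Fin n → Fin m) k (D : List (Fin m) → ℤ) →
    sumTuples (allFin n) k (D ∘ map cl) ≡ sumTuples (allFin m) k (weighted (λ c → + count cl c) D)
  sumTuples-blowup cl zero    D = sym (ℤ.*-identityˡ (D []))
  sumTuples-blowup {n} {m} cl (suc k) D = begin
    sumL (allFin n) (λ x → sumTuples (allFin n) k (D ∘ (cl x ∷_) ∘ map cl))
      ≡⟨ sumL-cong (allFin n) (λ x → sumTuples-blowup cl k (D ∘ (cl x ∷_))) ⟩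
    sumL (allFin n) (λ x → F (cl x))
      ≡⟨ sum-fibres cl F ⟩
    sumL (allFin m) (λ c → w c * F c)
      ≡⟨ sumL-cong (allFin m) (λ c → trans (sym (sumTuples-scale (allFin m) k (w c) (weighted w (D ∘ (c ∷_)))))
           (sumTuples-cong (allFin m) k (λ s → sym (ℤ.*-assoc (w c) (weight w s) (D (c ∷ s)))))) ⟩
    sumTuples (allFin m) (suc k) (weighted w D) ∎
    where
    w = λ c → + count cl c
    F = λ c → sumTuples (allFin m) k (weighted w (D ∘ (c ∷_)))

  -- Vertices of one class have equal rows, so only tuples of distinct classes count, each weighted
  -- by the product of the class sizes. Cancelling k! returns from tuples to sublists.
  minors-blowup : ∀ {n m} (G : Graph n) (cl : Fin n → Fin m) (P : Fin m → Fin m → Bool) →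
    (∀ i j → adj G i j ≡ P (cl i) (cl j)) →
    ∀ k → minors G k ≡ sumSublists (allFin m) k (weighted (λ c → + count cl c) (principal (λ c d → entry (P c d))))
  minors-blowup {n} {m} G cl P e k = ℤ.*-cancelˡ-≡ (+ (k !)) _ _ {{k ℕ.!≢0}} (begin
    + (k !) * minors G k
      ≡⟨ sumTuples≡sumSublists (allFin n) k D (principal-symmetric (negAdj G)) (principal-vanishes (negAdj G)) ⟨
    sumTuples (allFin n) k D
      ≡⟨ sumTuples-cong (allFin n) k (λ s → detL-resp (PW.map (λ { refl refl → cong entry (e _ _) }) (classes s)) (classes s)) ⟩
    sumTuples (allFin n) k (DP ∘ map cl)
      ≡⟨ sumTuples-blowup cl k DP ⟩
    sumTuples (allFin m) k (weighted w DP)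
      ≡⟨ sumTuples≡sumSublists (allFin m) k _ (weighted-symmetric w DP (principal-symmetric N)) (weighted-vanishes w DP (principal-vanishes N)) ⟩
    + (k !) * sumSublists (allFin m) k (weighted w DP) ∎)
    where
    D = principal (negAdj G)
    N = λ c d → entry (P c d)
    DP = principal N
    w = λ c → + count cl c
    classes : ∀ s → Pointwise (λ i c → c ≡ cl i) s (map cl s)
    classes []      = []
    classes (_ ∷ s) = refl ∷ classes s

open BlowUps

-- Minors of the weighted path

module PathPattern where

  open import Data.Integer using (_+_; _*_; _-_)

  -- `0F` to `4F` form P₅ in this order; `5F` is adjacent to nothing and collects the isolated
  -- vertices.
  path : Fin 6 → Fin 6 → Bool
  path c d = next c d ∨ next d c
    where
    next : Fin 6 → Fin 6 → Bool
    next c d = (suc (toℕ c) ≡ᵇ toℕ d) ∧ (toℕ d <ᵇ 5)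

  module _ (w : Fin 6 → ℤ) where

    pathMinors : ℕ → ℤ
    pathMinors k = sumSublists (allFin 6) k (weighted w (principal (λ c d → entry (path c d))))

    pathMinors-1 : pathMinors 1 ≡ + 0
    pathMinors-1 = lem (w 0F) (w 1F) (w 2F) (w 3F) (w 4F) (w 5F)
      where
      -- the left-hand side is pathMinors 1 unfolded
      lem : ∀ a b c d e z →
        ((((((+ 0 + (z * + 1) * + 0) + (e * + 1) * + 0) + (d * + 1) * + 0) + (c * + 1) * + 0) + (b
        * + 1) * + 0) + (a * + 1) * + 0)
        ≡ + 0
      lem = solve-∀

    pathMinors-2 : pathMinors 2 ≡ - (w 0F * w 1F + w 1F * w 2F + w 2F * w 3F + w 3F * w 4F)
    pathMinors-2 = lem (w 0F) (w 1F) (w 2F) (w 3F) (w 4F) (w 5F)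
      where
      lem : ∀ a b c d e z →
        ((((((+ 0 + + 0) + (+ 0 + (e * (z * + 1)) * + 0)) + ((+ 0 + (d * (z * + 1)) * + 0) + (d *
        (e * + 1)) * -[1+ 0 ])) + (((+ 0 + (c * (z * + 1)) * + 0) + (c * (e * + 1)) * + 0) + (c *
        (d * + 1)) * -[1+ 0 ])) + ((((+ 0 + (b * (z * + 1)) * + 0) + (b * (e * + 1)) * + 0) + (b *
        (d * + 1)) * + 0) + (b * (c * + 1)) * -[1+ 0 ])) + (((((+ 0 + (a * (z * + 1)) * + 0) + (a
        * (e * + 1)) * + 0) + (a * (d * + 1)) * + 0) + (a * (c * + 1)) * + 0) + (a * (b * + 1)) *
        -[1+ 0 ]))
        ≡ - (a * b + b * c + c * d + d * e)
      lem = solve-∀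

    -- A bipartite graph of odd order has a singular adjacency matrix.
    pathMinors-3 : pathMinors 3 ≡ + 0
    pathMinors-3 = lem (w 0F) (w 1F) (w 2F) (w 3F) (w 4F) (w 5F)
      where
      lem : ∀ a b c d e z →
        ((((((+ 0 + + 0) + (+ 0 + + 0)) + ((+ 0 + + 0) + (+ 0 + (d * (e * (z * + 1))) * + 0))) +
        (((+ 0 + + 0) + (+ 0 + (c * (e * (z * + 1))) * + 0)) + ((+ 0 + (c * (d * (z * + 1))) * +
        0) + (c * (d * (e * + 1))) * + 0))) + ((((+ 0 + + 0) + (+ 0 + (b * (e * (z * + 1))) * +
        0)) + ((+ 0 + (b * (d * (z * + 1))) * + 0) + (b * (d * (e * + 1))) * + 0)) + (((+ 0 + (b *
        (c * (z * + 1))) * + 0) + (b * (c * (e * + 1))) * + 0) + (b * (c * (d * + 1))) * + 0))) +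
        (((((+ 0 + + 0) + (+ 0 + (a * (e * (z * + 1))) * + 0)) + ((+ 0 + (a * (d * (z * + 1))) * +
        0) + (a * (d * (e * + 1))) * + 0)) + (((+ 0 + (a * (c * (z * + 1))) * + 0) + (a * (c * (e
        * + 1))) * + 0) + (a * (c * (d * + 1))) * + 0)) + ((((+ 0 + (a * (b * (z * + 1))) * + 0) +
        (a * (b * (e * + 1))) * + 0) + (a * (b * (d * + 1))) * + 0) + (a * (b * (c * + 1))) * +
        0)))
        ≡ + 0
      lem = solve-∀

    -- On four vertices an induced forest has minor 1 if it has a perfect matching, and 0 otherwise.
    -- Three vertex sets have one: two copies of P₄ and one of 2K₂.
    pathMinors-4 : pathMinors 4 ≡ w 0F * w 1F * w 2F * w 3F + w 0F * w 1F * w 3F * w 4F + w 1F * w 2F * w 3F * w 4F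
    pathMinors-4 = lem (w 0F) (w 1F) (w 2F) (w 3F) (w 4F) (w 5F)
      where
      lem : ∀ a b c d e z →
        ((((((+ 0 + + 0) + (+ 0 + + 0)) + ((+ 0 + + 0) + (+ 0 + + 0))) + (((+ 0 + + 0) + (+ 0 + +
        0)) + ((+ 0 + + 0) + (+ 0 + (c * (d * (e * (z * + 1)))) * + 0)))) + ((((+ 0 + + 0) + (+ 0
        + + 0)) + ((+ 0 + + 0) + (+ 0 + (b * (d * (e * (z * + 1)))) * + 0))) + (((+ 0 + + 0) + (+
        0 + (b * (c * (e * (z * + 1)))) * + 0)) + ((+ 0 + (b * (c * (d * (z * + 1)))) * + 0) + (b
        * (c * (d * (e * + 1)))) * + 1)))) + (((((+ 0 + + 0) + (+ 0 + + 0)) + ((+ 0 + + 0) + (+ 0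
        + (a * (d * (e * (z * + 1)))) * + 0))) + (((+ 0 + + 0) + (+ 0 + (a * (c * (e * (z * +
        1)))) * + 0)) + ((+ 0 + (a * (c * (d * (z * + 1)))) * + 0) + (a * (c * (d * (e * + 1)))) *
        + 0))) + ((((+ 0 + + 0) + (+ 0 + (a * (b * (e * (z * + 1)))) * + 0)) + ((+ 0 + (a * (b *
        (d * (z * + 1)))) * + 0) + (a * (b * (d * (e * + 1)))) * + 1)) + (((+ 0 + (a * (b * (c *
        (z * + 1)))) * + 0) + (a * (b * (c * (e * + 1)))) * + 0) + (a * (b * (c * (d * + 1)))) * +
        1))))
        ≡ a * b * c * d + a * b * d * e + b * c * d * e
      lem = solve-∀

    pathMinors-5 : pathMinors 5 ≡ + 0
    pathMinors-5 = lem (w 0F) (w 1F) (w 2F) (w 3F) (w 4F) (w 5F)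
      where
      lem : ∀ a b c d e z →
        ((((((+ 0 + + 0) + (+ 0 + + 0)) + ((+ 0 + + 0) + (+ 0 + + 0))) + (((+ 0 + + 0) + (+ 0 + +
        0)) + ((+ 0 + + 0) + (+ 0 + + 0)))) + ((((+ 0 + + 0) + (+ 0 + + 0)) + ((+ 0 + + 0) + (+ 0
        + + 0))) + (((+ 0 + + 0) + (+ 0 + + 0)) + ((+ 0 + + 0) + (+ 0 + (b * (c * (d * (e * (z * +
        1))))) * + 0))))) + (((((+ 0 + + 0) + (+ 0 + + 0)) + ((+ 0 + + 0) + (+ 0 + + 0))) + (((+ 0
        + + 0) + (+ 0 + + 0)) + ((+ 0 + + 0) + (+ 0 + (a * (c * (d * (e * (z * + 1))))) * + 0))))
        + ((((+ 0 + + 0) + (+ 0 + + 0)) + ((+ 0 + + 0) + (+ 0 + (a * (b * (d * (e * (z * + 1)))))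
        * + 0))) + (((+ 0 + + 0) + (+ 0 + (a * (b * (c * (e * (z * + 1))))) * + 0)) + ((+ 0 + (a *
        (b * (c * (d * (z * + 1))))) * + 0) + (a * (b * (c * (d * (e * + 1))))) * + 0)))))
        ≡ + 0
      lem = solve-∀

    -- The only sublist of length six contains the isolated class.
    pathMinors-6 : pathMinors 6 ≡ + 0
    pathMinors-6 = lem (w 0F) (w 1F) (w 2F) (w 3F) (w 4F) (w 5F)
      where
      lem : ∀ a b c d e z →
        ((((((+ 0 + + 0) + (+ 0 + + 0)) + ((+ 0 + + 0) + (+ 0 + + 0))) + (((+ 0 + + 0) + (+ 0 + +
        0)) + ((+ 0 + + 0) + (+ 0 + + 0)))) + ((((+ 0 + + 0) + (+ 0 + + 0)) + ((+ 0 + + 0) + (+ 0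
        + + 0))) + (((+ 0 + + 0) + (+ 0 + + 0)) + ((+ 0 + + 0) + (+ 0 + + 0))))) + (((((+ 0 + + 0)
        + (+ 0 + + 0)) + ((+ 0 + + 0) + (+ 0 + + 0))) + (((+ 0 + + 0) + (+ 0 + + 0)) + ((+ 0 + +
        0) + (+ 0 + + 0)))) + ((((+ 0 + + 0) + (+ 0 + + 0)) + ((+ 0 + + 0) + (+ 0 + + 0))) + (((+
        0 + + 0) + (+ 0 + + 0)) + ((+ 0 + + 0) + (+ 0 + (a * (b * (c * (d * (e * (z * + 1)))))) *
        + 0))))))
        ≡ + 0
      lem = solve-∀

open PathPattern

-- Exhaustive computation with small labelled graphs

module SmallGraphs where

  open import Data.Integer using (_+_; _*_; _-_)

  -- A strict triangle of adjacencies: the newest vertex, which has index 0, lists its adjacencies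
  -- to the earlier ones. Symmetry and absence of loops hold by construction, so an enumeration
  -- meets every labelled graph once.
  Tri : ℕ → Set
  Tri zero    = ⊤
  Tri (suc k) = Tri k × Vec Bool k

  ⟦_⟧ : ∀ {k} → Tri k → Fin k → Fin k → Bool
  ⟦_⟧ {suc k} (t , r) zero    zero    = false
  ⟦_⟧ {suc k} (t , r) zero    (suc j) = lookup r j
  ⟦_⟧ {suc k} (t , r) (suc i) zero    = lookup r i
  ⟦_⟧ {suc k} (t , r) (suc i) (suc j) = ⟦ t ⟧ i j

  -- `contr` for the entries 0 and -1; the cofactor of a zero entry is never evaluated in the
  -- exhaustive checks.
  contrᵇ : ∀ {I : Set} → (I → Bool) → (List I → ℤ) → List I → ℤ
  contrᵇ v φ []       = + 0
  contrᵇ v φ (c ∷ cs) = if v c then (- φ cs) - contrᵇ v (φ ∘ (c ∷_)) cs else - contrᵇ v (φ ∘ (c ∷_)) cs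

  detᵇ : ∀ {I : Set} → (I → I → Bool) → List I → List I → ℤ
  detᵇ N []       []      = + 1
  detᵇ N []       (_ ∷ _) = + 0
  detᵇ N (r ∷ rs)         = contrᵇ (N r) (detᵇ N rs)

  -- Opaque because unfolding it at symbolic arguments is infeasible.
  opaque
    minor : ∀ {k} → Tri k → ℤ
    minor {k} t = detᵇ ⟦ t ⟧ (allFin k) (allFin k)

  allB : ∀ k → (Fin k → Bool) → Bool
  allB zero    p = true
  allB (suc k) p = p zero ∧ allB k (p ∘ suc)

  allVec : ∀ k → (Vec Bool k → Bool) → Bool
  allVec zero    p = p []
  allVec (suc k) p = allVec k (p ∘ (false ∷_)) ∧ allVec k (p ∘ (true ∷_))

  infixr 3 _⇒_
  -- By `if`, so that a false premise stops the evaluation.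
  _⇒_ : Bool → Bool → Bool
  a ⇒ b = if a then b else true

  -- A new vertex creates no triangle exactly if its neighbourhood is independent. Testing this
  -- vertex by vertex prunes the enumeration.
  extendable : ∀ {k} → Tri k → Vec Bool k → Bool
  extendable {k} t r = allB k (λ i → lookup r i ⇒ allB k (λ j → lookup r j ⇒ not (⟦ t ⟧ i j)))

  allTriangleFree : ∀ k → (Tri k → Bool) → Bool
  allTriangleFree zero    p = p tt
  allTriangleFree (suc k) p = allTriangleFree k (λ t → allVec k (λ r → extendable t r ⇒ p (t , r)))

  ⇒-elim : ∀ {a b} → (a ⇒ b) ≡ true → a ≡ true → b ≡ true
  ⇒-elim e refl = e

  ⇒-intro : ∀ a {b} → (a ≡ true → b ≡ true) → (a ⇒ b) ≡ true
  ⇒-intro true  f = f refl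
  ⇒-intro false f = refl

  allB-intro : ∀ k {p} → (∀ i → p i ≡ true) → allB k p ≡ true
  allB-intro zero    e = refl
  allB-intro (suc k) e rewrite e zero = allB-intro k (e ∘ suc)

  allVec-elim : ∀ k p → allVec k p ≡ true → ∀ r → p r ≡ true
  allVec-elim zero    p e []          = e
  allVec-elim (suc k) p e (false ∷ r) = allVec-elim k _ (∧-conicalˡ _ _ e) r
  allVec-elim (suc k) p e (true ∷ r)  = allVec-elim k _ (∧-conicalʳ _ _ e) r

  TriangleFree : ∀ {k} → Tri k → Set
  TriangleFree {zero}  t       = ⊤
  TriangleFree {suc k} (t , r) = TriangleFree t × extendable t r ≡ true

  allTriangleFree-elim : ∀ k p → allTriangleFree k p ≡ true → ∀ t → TriangleFree t → p t ≡ true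
  allTriangleFree-elim zero    p e t       _        = e
  allTriangleFree-elim (suc k) p e (t , r) (tf , x) =
    ⇒-elim (allVec-elim k _ (allTriangleFree-elim k _ e t tf) r) x

  nonpositive : ℤ → Bool
  nonpositive (+ zero)   = true
  nonpositive (+ suc _)  = false
  nonpositive (-[1+ _ ]) = true

  isZero : ℤ → Bool
  isZero (+ zero)   = true
  isZero (+ suc _)  = false
  isZero (-[1+ _ ]) = false

  nonpositive-sound : ∀ x → nonpositive x ≡ true → x ℤ.≤ + 0
  nonpositive-sound (+ zero)   _ = ℤ.≤-refl
  nonpositive-sound (-[1+ _ ]) _ = ℤ.-≤+

  isZero-sound : ∀ x → isZero x ≡ true → x ≡ + 0
  isZero-sound (+ zero) _ = refl

  contrᵇ≡contr : ∀ {I : Set} (v : I → Bool) {φ ψ : List I → ℤ} → (∀ cs → φ cs ≡ ψ cs) →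
    ∀ cs → contrᵇ v φ cs ≡ contr (entry ∘ v) ψ cs
  contrᵇ≡contr v e []       = refl
  contrᵇ≡contr v e (c ∷ cs) with v c
  ... | true  = cong₂ _-_ (trans (cong -_ (e cs)) (sym (ℤ.-1*i≡-i _))) (contrᵇ≡contr v (e ∘ (c ∷_)) cs)
  ... | false = trans (cong -_ (contrᵇ≡contr v (e ∘ (c ∷_)) cs)) (sym (ℤ.+-identityˡ _))

  detᵇ≡detL : ∀ {I : Set} (N : I → I → Bool) rs cs → detᵇ N rs cs ≡ detL (λ i j → entry (N i j)) rs cs
  detᵇ≡detL N []       []      = refl
  detᵇ≡detL N []       (_ ∷ _) = refl
  detᵇ≡detL N (r ∷ rs) cs      = contrᵇ≡contr (N r) (detᵇ≡detL N rs) cs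

  sumTuples-nonpositive : ∀ {n} k (D : List (Fin n) → ℤ) → (∀ (v : Fin k → Fin n) → D (tabulate v) ℤ.≤ + 0) → sumTuples (allFin n) k D ℤ.≤ + 0
  sumL-nonpositive : ∀ {A : Set} (xs : List A) {f : A → ℤ} → (∀ x → f x ℤ.≤ + 0) → sumL xs f ℤ.≤ + 0
  sumL-nonpositive []       h = ℤ.≤-refl
  sumL-nonpositive (x ∷ xs) h = ℤ.+-mono-≤ (h x) (sumL-nonpositive xs h)
  sumTuples-nonpositive zero    D h = h (λ ())
  sumTuples-nonpositive {n} (suc k) D h = sumL-nonpositive (allFin n) (λ x → sumTuples-nonpositive k (D ∘ (x ∷_)) (λ v → h (x ∷ᶠ v)))

  sumL-nonpositive-zero : ∀ n {f : Fin n → ℤ} → (∀ x → f x ℤ.≤ + 0) → sumL (allFin n) f ≡ + 0 → ∀ x → f x ≡ + 0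
  sumL-nonpositive-zero (suc n) {f} h e = all
    where
    rest = sumL (tabulate suc) f
    rest≤0 : rest ℤ.≤ + 0
    rest≤0 = sumL-nonpositive (tabulate suc) h
    head≡0 : f zero ≡ + 0
    head≡0 = ℤ.≤-antisym (h zero) (subst (ℤ._≤ f zero) e
      (ℤ.≤-trans (ℤ.+-monoʳ-≤ (f zero) rest≤0) (ℤ.≤-reflexive (ℤ.+-identityʳ (f zero)))))
    rest≡0 : rest ≡ + 0
    rest≡0 = trans (sym (ℤ.+-identityˡ rest)) (trans (cong (_+ rest) (sym head≡0)) e)
    all : ∀ x → f x ≡ + 0
    all zero    = head≡0
    all (suc x) = sumL-nonpositive-zero n (h ∘ suc) (trans (sym (sumL-tabulate n suc f)) rest≡0) x

  sumTuples-nonpositive-zero : ∀ {n} k (D : List (Fin n) → ℤ) → (∀ (v : Fin k → Fin n) → D (tabulate v) ℤ.≤ + 0) →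
    sumTuples (allFin n) k D ≡ + 0 → ∀ (v : Fin k → Fin n) → D (tabulate v) ≡ + 0
  sumTuples-nonpositive-zero         zero    D h e v = e
  sumTuples-nonpositive-zero {n = n} (suc k) D h e v =
    sumTuples-nonpositive-zero k (D ∘ (v zero ∷_)) (λ u → h (v zero ∷ᶠ u))
      (sumL-nonpositive-zero n (λ x → sumTuples-nonpositive k (D ∘ (x ∷_)) (λ u → h (x ∷ᶠ u))) e (v zero)) (v ∘ suc)

  sumTuples-all-zero : ∀ {n} k (D : List (Fin n) → ℤ) → (∀ (v : Fin k → Fin n) → D (tabulate v) ≡ + 0) → sumTuples (allFin n) k D ≡ + 0
  sumTuples-all-zero         zero    D h = h (λ ())
  sumTuples-all-zero {n = n} (suc k) D h = sumL-zero (allFin n) (λ x → sumTuples-all-zero k (D ∘ (x ∷_)) (λ v → h (x ∷ᶠ v)))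

  restrict : ∀ {n k} → Graph n → (Fin k → Fin n) → Tri k
  restrict {k = zero}  G v = tt
  restrict {k = suc k} G v = restrict G (v ∘ suc) , Vec.tabulate (λ j → adj G (v zero) (v (suc j)))

  module _ {n} (G : Graph n) where

    restrict-adj : ∀ {k} (v : Fin k → Fin n) i j → ⟦ restrict G v ⟧ i j ≡ adj G (v i) (v j)
    restrict-adj v zero    zero    = sym (irrefl G (v zero))
    restrict-adj v zero    (suc j) = lookup∘tabulate _ j
    restrict-adj v (suc i) zero    = trans (lookup∘tabulate _ i) (adj-sym G (v zero) (v (suc i)))
    restrict-adj v (suc i) (suc j) = restrict-adj (v ∘ suc) i j

    opaque
      unfolding minor
      minor-restrict : ∀ {k} (v : Fin k → Fin n) → minor (restrict G v) ≡ principal (negAdj G) (tabulate v)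
      minor-restrict {k} v = trans (detᵇ≡detL _ (allFin k) (allFin k))
        (detL-resp (PW.map (λ { refl refl → cong entry (restrict-adj v _ _) }) vertices) vertices)
        where
        along : ∀ {k l} (f : Fin k → Fin l) (g : Fin k → Fin n) (h : Fin l → Fin n) → (∀ i → g i ≡ h (f i)) →
          Pointwise (λ i x → x ≡ h i) (tabulate f) (tabulate g)
        along {zero}  f g h e = []
        along {suc k} f g h e = e zero ∷ along (f ∘ suc) (g ∘ suc) h (e ∘ suc)
        vertices : Pointwise (λ i x → x ≡ v i) (allFin k) (tabulate v)
        vertices = along id v v (λ _ → refl)

    -- The sum over all tuples is k! times the sum of minors, hence zero, and none of its terms is
    -- positive. So each term vanishes, also for maps `v` that are not injective.
    minors-zero : ∀ k → minors G k ≡ + 0 → (∀ (v : Fin k → Fin n) → nonpositive (minor (restrict G v)) ≡ true) →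
      ∀ (v : Fin k → Fin n) → minor (restrict G v) ≡ + 0
    minors-zero k e h v = trans (minor-restrict v)
      (sumTuples-nonpositive-zero k D (λ v → subst (ℤ._≤ + 0) (minor-restrict v) (nonpositive-sound _ (h v)))
        (trans (sumTuples≡sumSublists (allFin n) k D (principal-symmetric (negAdj G)) (principal-vanishes (negAdj G)))
               (trans (cong (+ (k ℕ.!) *_) e) (ℤ.*-zeroʳ (+ (k ℕ.!))))) v)
      where
      D = principal (negAdj G)

    all-zero⇒minors-zero : ∀ k → (∀ (v : Fin k → Fin n) → minor (restrict G v) ≡ + 0) → minors G k ≡ + 0
    all-zero⇒minors-zero k h = ℤ.*-cancelˡ-≡ (+ (k ℕ.!)) _ (+ 0) {{k ℕ.!≢0}}
      (trans (sym (sumTuples≡sumSublists (allFin n) k D (principal-symmetric (negAdj G)) (principal-vanishes (negAdj G))))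
        (trans (sumTuples-all-zero k D (λ v → trans (sym (minor-restrict v)) (h v))) (sym (ℤ.*-zeroʳ (+ (k ℕ.!))))))
      where
      D = principal (negAdj G)

open SmallGraphs

-- Recognising blow-ups of P₅

module Classification where

  opaque
    unfolding minor

    -- The value is -2 on a triangle and 0 on the other graphs with three vertices.
    nonpositive3 : ∀ (t : Tri 3) → nonpositive (minor t) ≡ true
    nonpositive3 (((_ , []) , x ∷ []) , y ∷ z ∷ []) = allVec-elim 3 check refl (x ∷ y ∷ z ∷ [])
      where
      check : Vec Bool 3 → Bool
      check (x ∷ y ∷ z ∷ []) = nonpositive (minor (((tt , []) , x ∷ []) , y ∷ z ∷ []))

    minor3≡0⇒noTriangle : ∀ x y z → minor (((tt , []) , x ∷ []) , y ∷ z ∷ []) ≡ + 0 → y ≡ true → z ≡ true → x ≡ false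
    minor3≡0⇒noTriangle false true true _ _ _ = refl

  -- In a triangle-free graph this is an induced P₄: a chord ac or bd, or the coincidence of a and
  -- d, would give a triangle, and the other coincidences contradict the tested entries.
  isP4 : ∀ {I : Set} → (I → I → Bool) → I → I → I → I → Bool
  isP4 m a b c d = m a b ∧ m b c ∧ m c d ∧ not (m a d)

  is2K2 : ∀ {I : Set} → (I → I → Bool) → I → I → I → I → Bool
  is2K2 m a b c d = m a b ∧ m c d ∧ not (m a c) ∧ not (m a d) ∧ not (m b c) ∧ not (m b d)

  quadsFree : Tri 4 → Bool
  quadsFree t = allB 4 (λ a → allB 4 (λ b → allB 4 (λ c → allB 4 (λ d → not (isP4 ⟦ t ⟧ a b c d) ∧ not (is2K2 ⟦ t ⟧ a b c d)))))

  p4 k2 : Tri 4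
  p4 = (((tt , []) , true ∷ []) , true ∷ false ∷ []) , true ∷ false ∷ false ∷ []
  k2 = (((tt , []) , true ∷ []) , false ∷ false ∷ []) , true ∷ false ∷ false ∷ []

  -- `onlyFirst` and `onlyLast` describe vertices that prolong the path P₄ beyond one end,
  -- `crossing` those that meet both edges of 2K₂.
  onlyFirst onlyLast crossing : Vec Bool 4 → Bool
  onlyFirst (a ∷ b ∷ c ∷ d ∷ []) = a ∧ not b ∧ not c ∧ not d
  onlyLast (a ∷ b ∷ c ∷ d ∷ [])  = onlyFirst (d ∷ c ∷ b ∷ a ∷ [])
  crossing (a ∷ b ∷ c ∷ d ∷ [])  = (a ∨ b) ∧ (c ∨ d)

  -- The class of a vertex, read off its neighbours among the four base vertices.
  classP4 class2K2 : Vec Bool 4 → Fin 6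
  classP4 (true  ∷ false ∷ false ∷ false ∷ []) = 0F
  classP4 (false ∷ true  ∷ false ∷ false ∷ []) = 1F
  classP4 (true  ∷ false ∷ true  ∷ false ∷ []) = 2F
  classP4 (false ∷ true  ∷ false ∷ true  ∷ []) = 3F
  classP4 (false ∷ false ∷ true  ∷ false ∷ []) = 4F
  classP4 _                                    = 5F
  class2K2 (false ∷ true  ∷ false ∷ false ∷ []) = 0F
  class2K2 (true  ∷ false ∷ false ∷ false ∷ []) = 1F
  class2K2 (false ∷ false ∷ false ∷ true  ∷ []) = 3F
  class2K2 (false ∷ false ∷ true  ∷ false ∷ []) = 4F
  class2K2 _                                    = 5F

  _==_ : Bool → Bool → Bool
  true  == b = b
  false == b = not b

  ==-sound : ∀ a b → (a == b) ≡ true → a ≡ b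
  ==-sound true  true  _ = refl
  ==-sound false false _ = refl

  -- The six vertices are w, u and the base; `r` and `s` are the neighbours of u and w in the base,
  -- and `x` is the adjacency of w and u. The premises are absence of triangles and vanishing of the
  -- minors of orders 5 and 6.
  singular : Tri 4 → Vec Bool 4 → Vec Bool 5 → Bool → Bool
  singular base r (x ∷ s) b =
    extendable base r ⇒ extendable (base , r) (x ∷ s) ⇒
    isZero (minor (base , r)) ⇒ isZero (minor (base , s)) ⇒ isZero (minor ((base , r) , x ∷ s)) ⇒ b

  checkEnds checkP4 check2K2 : Vec Bool 4 → Vec Bool 5 → Bool
  checkEnds r (x ∷ s) = singular p4 r (x ∷ s) (onlyFirst r ⇒ not (onlyLast s))
  checkP4   r (x ∷ s) = singular p4 r (x ∷ s) (not (onlyLast r) ⇒ not (onlyLast s) ⇒ (x == path (classP4 s) (classP4 r)))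
  check2K2  r (x ∷ s) = singular k2 r (x ∷ s) (not (crossing r) ⇒ not (crossing s) ⇒ (x == path (class2K2 s) (class2K2 r)))

  opaque
    unfolding minor

    -- The inverse of the adjacency matrix of P₄ has entry -1 at the pair of ends, so two vertices
    -- prolonging the path at different ends would need adjacency -1.
    ends-ok : allVec 4 (λ r → allVec 5 (checkEnds r)) ≡ true
    ends-ok = refl

    -- The premises leave seven types: the five listed in `classP4`, the excluded `onlyLast`, and no
    -- neighbour at all. The default `5F` thus receives only vertices without neighbours in the
    -- base.
    P4-ok : allVec 4 (λ r → allVec 5 (checkP4 r)) ≡ true
    P4-ok = refl

    -- Without triangles only a spanning 5-cycle contributes, and it has no chords: the minor is -2
    -- for C₅ and 0 otherwise.
    5-ok : allTriangleFree 5 (nonpositive ∘ minor) ≡ true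
    5-ok = refl

    -- A bipartite graph with parts of size 3 has as minor minus the square of its biadjacency
    -- determinant; without such parts the minor is 0. A non-bipartite triangle-free graph is C₅ and
    -- a vertex with zero, one or two neighbours on it, with minors 0, -1 and 0.
    6-ok : allTriangleFree 6 (nonpositive ∘ minor) ≡ true
    6-ok = refl

    -- Without triangles and crossings a vertex has at most one neighbour in the base; the middle
    -- class `2F` stays empty.
    2K2-ok : allVec 4 (λ r → allVec 5 (check2K2 r)) ≡ true
    2K2-ok = refl

    -- A triangle-free graph on four vertices with a perfect matching is 2K₂, P₄ or C₄, and C₄ is
    -- singular.
    quads-ok : allTriangleFree 4 (λ t → quadsFree t ⇒ isZero (minor t)) ≡ true
    quads-ok = refl

  check-elim : (check : Vec Bool 4 → Vec Bool 5 → Bool) → allVec 4 (λ r → allVec 5 (check r)) ≡ true →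
    ∀ r s → check r s ≡ true
  check-elim check e r = allVec-elim 5 (check r) (allVec-elim 4 (λ r → allVec 5 (check r)) e r)

  ∧-elim : ∀ {a b} → a ∧ b ≡ true → a ≡ true × b ≡ true
  ∧-elim e = ∧-conicalˡ _ _ e , ∧-conicalʳ _ _ e

  not-true : ∀ {a} → not a ≡ true → a ≡ false
  not-true {false} _ = refl

  not-intro : ∀ {a} → a ≡ false → not a ≡ true
  not-intro refl = refl

  Classified : ∀ {n} → Graph n → Set
  Classified {n} G = Σ (Fin n → Fin 6) λ cl → ∀ i j → adj G i j ≡ path (cl i) (cl j)

  module Structure {n} (G : Graph n) (m3 : minors G 3 ≡ + 0) (m5 : minors G 5 ≡ + 0) (m6 : minors G 6 ≡ + 0) where

    noTriangle : ∀ i j k → adj G i j ≡ true → adj G i k ≡ true → adj G j k ≡ false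
    noTriangle i j k = minor3≡0⇒noTriangle (adj G j k) (adj G i j) (adj G i k)
      (minors-zero G 3 m3 (λ v → nonpositive3 (restrict G v)) (i ∷ᶠ j ∷ᶠ k ∷ᶠ []ᶠ))

    restrict-triangleFree : ∀ {k} (v : Fin k → Fin n) → TriangleFree (restrict G v)
    restrict-triangleFree {zero}  v = tt
    restrict-triangleFree {suc k} v = restrict-triangleFree (v ∘ suc) ,
      allB-intro k (λ i → ⇒-intro (lookup r i) (λ e → allB-intro k (λ j → ⇒-intro (lookup r j) (λ e′ →
        not-intro (trans (restrict-adj G (v ∘ suc) i j)
          (noTriangle (v zero) (v (suc i)) (v (suc j)) (trans (sym (lookup∘tabulate _ i)) e) (trans (sym (lookup∘tabulate _ j)) e′)))))))
      where r = Vec.tabulate (λ j → adj G (v zero) (v (suc j)))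

    zero5 : ∀ (v : Fin 5 → Fin n) → minor (restrict G v) ≡ + 0
    zero5 = minors-zero G 5 m5 (λ v → allTriangleFree-elim 5 (nonpositive ∘ minor) 5-ok (restrict G v) (restrict-triangleFree v))

    zero6 : ∀ (v : Fin 6 → Fin n) → minor (restrict G v) ≡ + 0
    zero6 = minors-zero G 6 m6 (λ v → allTriangleFree-elim 6 (nonpositive ∘ minor) 6-ok (restrict G v) (restrict-triangleFree v))

    module Base (base : Fin 4 → Fin n) where

      type : Fin n → Vec Bool 4
      type u = Vec.tabulate (λ i → adj G u (base i))

      singular-elim : ∀ {t} → restrict G base ≡ t → ∀ u w b → singular t (type u) (adj G w u ∷ type w) b ≡ true → b ≡ true
      singular-elim refl u w b e = ⇒-elim (⇒-elim (⇒-elim (⇒-elim (⇒-elim e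
        (proj₂ (restrict-triangleFree (u ∷ᶠ base)))) (proj₂ (restrict-triangleFree (w ∷ᶠ u ∷ᶠ base))))
        (cong isZero (zero5 (u ∷ᶠ base)))) (cong isZero (zero5 (w ∷ᶠ base)))) (cong isZero (zero6 (w ∷ᶠ u ∷ᶠ base)))

    module P4 (i j k l : Fin n) (ij : adj G i j ≡ true) (jk : adj G j k ≡ true) (kl : adj G k l ≡ true) (il : adj G i l ≡ false) where
      base : Fin 4 → Fin n
      base = i ∷ᶠ j ∷ᶠ k ∷ᶠ l ∷ᶠ []ᶠ
      open Base base public

      restrict-base : restrict G base ≡ p4
      restrict-base rewrite kl | jk | noTriangle k j l (trans (adj-sym G k j) jk) kl
                          | ij | noTriangle j i k (trans (adj-sym G j i) ij) jk | il = refl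

      ends : ∀ u w → onlyFirst (type u) ≡ true → onlyLast (type w) ≡ false
      ends u w e = not-true (⇒-elim (singular-elim restrict-base u w (onlyFirst (type u) ⇒ not (onlyLast (type w)))
        (check-elim checkEnds ends-ok (type u) (adj G w u ∷ type w))) e)

      classify : (∀ u → onlyLast (type u) ≡ false) → Classified G
      classify h = classP4 ∘ type , λ w u → ==-sound _ _
        (⇒-elim (⇒-elim (singular-elim restrict-base u w
          (not (onlyLast (type u)) ⇒ not (onlyLast (type w)) ⇒ (adj G w u == path (classP4 (type w)) (classP4 (type u))))
          (check-elim checkP4 P4-ok (type u) (adj G w u ∷ type w))) (not-intro (h u))) (not-intro (h w)))

    classifyP4 : ∀ i j k l → isP4 (adj G) i j k l ≡ true → Classified G
    classifyP4 i j k l e = result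
      where
      e₁ = ∧-elim {adj G i j} e
      e₂ = ∧-elim {adj G j k} (proj₂ e₁)
      e₃ = ∧-elim {adj G k l} (proj₂ e₂)
      ij = proj₁ e₁
      jk = proj₁ e₂
      kl = proj₁ e₃
      il = not-true {adj G i l} (proj₂ e₃)
      module F = P4 i j k l ij jk kl il
      module B = P4 l k j i (trans (adj-sym G l k) kl) (trans (adj-sym G k j) jk) (trans (adj-sym G j i) ij) (trans (adj-sym G l i) il)
      result : Classified G
      -- If some vertex prolongs the path at `l`, then none does at `i`, and the path is read
      -- backwards: `onlyLast` for `B` is `onlyFirst` for `F`.
      result with any? (λ u → onlyLast (F.type u) Bool.≟ true)
      ... | yes (f , last) = B.classify (λ u → ¬-not (λ first → contradiction (trans (sym last) (F.ends u f first)) λ ()))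
      ... | no ¬last = F.classify (λ u → ¬-not (λ last → ¬last (u , last)))

    classify2K2 : (∀ a b c d → isP4 (adj G) a b c d ≡ false) → ∀ i j k l → is2K2 (adj G) i j k l ≡ true → Classified G
    classify2K2 noP4 i j k l e = class2K2 ∘ type , λ w u → ==-sound _ _
        (⇒-elim (⇒-elim (singular-elim restrict-base u w
          (not (crossing (type u)) ⇒ not (crossing (type w)) ⇒ (adj G w u == path (class2K2 (type w)) (class2K2 (type u))))
          (check-elim check2K2 2K2-ok (type u) (adj G w u ∷ type w))) (not-intro (uncrossed u))) (not-intro (uncrossed w)))
      where
      base : Fin 4 → Fin n
      base = i ∷ᶠ j ∷ᶠ k ∷ᶠ l ∷ᶠ []ᶠ
      open Base base
      e₁ = ∧-elim e
      e₂ = ∧-elim (proj₂ e₁)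
      e₃ = ∧-elim (proj₂ e₂)
      e₄ = ∧-elim (proj₂ e₃)
      e₅ = ∧-elim (proj₂ e₄)
      ij : adj G i j ≡ true
      ij = proj₁ e₁
      kl : adj G k l ≡ true
      kl = proj₁ e₂
      ik : adj G i k ≡ false
      ik = not-true (proj₁ e₃)
      il : adj G i l ≡ false
      il = not-true (proj₁ e₄)
      jk : adj G j k ≡ false
      jk = not-true (proj₁ e₅)
      jl : adj G j l ≡ false
      jl = not-true (proj₂ e₅)
      restrict-base : restrict G base ≡ k2
      restrict-base rewrite kl | jk | jl | ij | ik | il = refl
      noPath : ∀ a b c d → adj G a b ≡ true → adj G a d ≡ false → adj G b c ∧ adj G c d ≡ false
      noPath a b c d ab ad with adj G b c in bc | adj G c d in cd
      ... | false | _     = refl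
      ... | true  | false = refl
      ... | true  | true  with trans (sym (noP4 a b c d)) (isP4-intro ab bc cd ad)
        where
        isP4-intro : adj G a b ≡ true → adj G b c ≡ true → adj G c d ≡ true → adj G a d ≡ false → isP4 (adj G) a b c d ≡ true
        isP4-intro ab bc cd ad rewrite ab | bc | cd | ad = refl
      ... | ()
      cross : ∀ {a b c d} → a ∧ c ≡ false → a ∧ d ≡ false → b ∧ c ≡ false → b ∧ d ≡ false → (a ∨ b) ∧ (c ∨ d) ≡ false
      cross {false} {false}                  _ _ _ _ = refl
      cross {false} {true}  {false} {false}  _ _ _ _ = refl
      cross {true}  {false} {false} {false}  _ _ _ _ = refl
      cross {true}  {true}  {false} {false}  _ _ _ _ = refl
      ji = trans (adj-sym G j i) ij
      -- A vertex meeting both edges would be the third vertex of an induced P₄ that starts with the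
      -- first edge.
      uncrossed : ∀ u → crossing (type u) ≡ false
      uncrossed u = cross {adj G u i} {adj G u j}
        (trans (cong (_∧ adj G u k) (adj-sym G u i)) (noPath j i u k ji jk))
        (trans (cong (_∧ adj G u l) (adj-sym G u i)) (noPath j i u l ji jl))
        (trans (cong (_∧ adj G u k) (adj-sym G u j)) (noPath i j u k ij ik))
        (trans (cong (_∧ adj G u l) (adj-sym G u j)) (noPath i j u l ij il))

    classification : minors G 4 ≢ + 0 → Classified G
    classification m4 with any? (λ a → any? (λ b → any? (λ c → any? (λ d → isP4 (adj G) a b c d Bool.≟ true))))
    ... | yes (a , b , c , d , e) = classifyP4 a b c d e
    ... | no ¬P4 with any? (λ a → any? (λ b → any? (λ c → any? (λ d → is2K2 (adj G) a b c d Bool.≟ true))))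
    ...   | yes (a , b , c , d , e) = classify2K2 (λ a b c d → ¬-not (λ e → ¬P4 (a , b , c , d , e))) a b c d e
    ...   | no ¬2K2 = contradiction (all-zero⇒minors-zero G 4 (λ v → isZero-sound _
              (⇒-elim (allTriangleFree-elim 4 (λ t → quadsFree t ⇒ isZero (minor t)) quads-ok (restrict G v) (restrict-triangleFree v))
                (allB-intro 4 (λ a → allB-intro 4 (λ b → allB-intro 4 (λ c → allB-intro 4 (λ d →
                  cong₂ _∧_ (not-intro (noQuad v a b c d)) (not-intro (no2K2 v a b c d)))))))))) m4
      where
      noQuad : ∀ (v : Fin 4 → Fin n) a b c d → isP4 ⟦ restrict G v ⟧ a b c d ≡ false
      noQuad v a b c d = ¬-not (λ e → ¬P4 (v a , v b , v c , v d , trans (sym same) e))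
        where
        same : isP4 ⟦ restrict G v ⟧ a b c d ≡ isP4 (adj G) (v a) (v b) (v c) (v d)
        same rewrite restrict-adj G v a b | restrict-adj G v b c | restrict-adj G v c d | restrict-adj G v a d = refl
      no2K2 : ∀ (v : Fin 4 → Fin n) a b c d → is2K2 ⟦ restrict G v ⟧ a b c d ≡ false
      no2K2 v a b c d = ¬-not (λ e → ¬2K2 (v a , v b , v c , v d , trans (sym same) e))
        where
        same : is2K2 ⟦ restrict G v ⟧ a b c d ≡ is2K2 (adj G) (v a) (v b) (v c) (v d)
        same rewrite restrict-adj G v a b | restrict-adj G v c d | restrict-adj G v a c | restrict-adj G v a d
                   | restrict-adj G v b c | restrict-adj G v b d = refl

open Classification

-- Graphs described by class sizes

module Weights where

  open import Data.Integer using (_+_; _*_; _-_)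

  -- Up to sign the coefficients of orders 2 and 4 for a blow-up of P₅ with these class sizes.
  pathEdges pathQuads : (a b c d e : ℕ) → ℕ
  pathEdges a b c d e = a ℕ.* b ℕ.+ b ℕ.* c ℕ.+ c ℕ.* d ℕ.+ d ℕ.* e
  pathQuads a b c d e = a ℕ.* b ℕ.* c ℕ.* d ℕ.+ a ℕ.* b ℕ.* d ℕ.* e ℕ.+ b ℕ.* c ℕ.* d ℕ.* e

  edges quads : (Fin 6 → ℕ) → ℕ
  edges w = pathEdges (w 0F) (w 1F) (w 2F) (w 3F) (w 4F)
  quads w = pathQuads (w 0F) (w 1F) (w 2F) (w 3F) (w 4F)

  edges-cong : ∀ {v w} → (∀ c → v c ≡ w c) → edges v ≡ edges w
  edges-cong e rewrite e 0F | e 1F | e 2F | e 3F | e 4F = refl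

  quads-cong : ∀ {v w} → (∀ c → v c ≡ w c) → quads v ≡ quads w
  quads-cong e rewrite e 0F | e 1F | e 2F | e 3F | e 4F = refl

  signature : ℕ → ℕ → ℕ → ℤ
  signature m s 0 = + 1
  signature m s 2 = - + m
  signature m s 4 = + s
  signature m s _ = + 0

  -- The sizes are an index and not computed from `class`, so that graphs with different class maps
  -- are compared by numbers alone.
  record HasWeights {n} (G : Graph n) (w : Fin 6 → ℕ) : Set where
    constructor weights
    field
      class   : Fin n → Fin 6
      adjacent : ∀ i j → adj G i j ≡ path (class i) (class j)
      counts  : ∀ c → count class c ≡ w c
  open HasWeights

  pos-product : ∀ a b c d → + (a ℕ.* b ℕ.* c ℕ.* d) ≡ + a * + b * + c * + d
  pos-product a b c d = trans (ℤ.pos-* (a ℕ.* b ℕ.* c) d) (cong (_* + d) (trans (ℤ.pos-* (a ℕ.* b) c) (cong (_* + c) (ℤ.pos-* a b))))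

  pathMinors-signature : ∀ (w : Fin 6 → ℕ) k → pathMinors (λ c → + w c) k ≡ signature (edges w) (quads w) k
  pathMinors-signature w 0 = refl
  pathMinors-signature w 1 = pathMinors-1 (λ c → + w c)
  pathMinors-signature w 2 = trans (pathMinors-2 (λ c → + w c)) (cong -_ (sym (
    trans (ℤ.pos-+ (w 0F ℕ.* w 1F ℕ.+ w 1F ℕ.* w 2F ℕ.+ w 2F ℕ.* w 3F) (w 3F ℕ.* w 4F)) (cong₂ _+_
    (trans (ℤ.pos-+ (w 0F ℕ.* w 1F ℕ.+ w 1F ℕ.* w 2F) (w 2F ℕ.* w 3F)) (cong₂ _+_
    (trans (ℤ.pos-+ (w 0F ℕ.* w 1F) (w 1F ℕ.* w 2F)) (cong₂ _+_ (ℤ.pos-* (w 0F) (w 1F)) (ℤ.pos-* (w 1F) (w 2F))))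
    (ℤ.pos-* (w 2F) (w 3F)))) (ℤ.pos-* (w 3F) (w 4F))))))
  pathMinors-signature w 3 = pathMinors-3 (λ c → + w c)
  pathMinors-signature w 4 = trans (pathMinors-4 (λ c → + w c)) (sym (
    trans (ℤ.pos-+ (w 0F ℕ.* w 1F ℕ.* w 2F ℕ.* w 3F ℕ.+ w 0F ℕ.* w 1F ℕ.* w 3F ℕ.* w 4F) (w 1F ℕ.* w 2F ℕ.* w 3F ℕ.* w 4F)) (cong₂ _+_
    (trans (ℤ.pos-+ (w 0F ℕ.* w 1F ℕ.* w 2F ℕ.* w 3F) (w 0F ℕ.* w 1F ℕ.* w 3F ℕ.* w 4F)) (cong₂ _+_
    (pos-product (w 0F) (w 1F) (w 2F) (w 3F)) (pos-product (w 0F) (w 1F) (w 3F) (w 4F)))) (pos-product (w 1F) (w 2F) (w 3F) (w 4F)))))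
  pathMinors-signature w 5 = pathMinors-5 (λ c → + w c)
  pathMinors-signature w 6 = pathMinors-6 (λ c → + w c)
  pathMinors-signature w (suc (suc (suc (suc (suc (suc (suc k))))))) =
    sumSublists-large (allFin 6) (7 ℕ.+ k) (weighted (λ c → + w c) (principal (λ c d → entry (path c d)))) (s≤s (s≤s (s≤s (s≤s (s≤s (s≤s (s≤s z≤n)))))))

  minors-weights : ∀ {n} {G : Graph n} {w} → HasWeights G w → ∀ k → minors G k ≡ signature (edges w) (quads w) k
  minors-weights {G = G} (weights cl e c) k = trans (minors-blowup G cl path e k)
    (trans (pathMinors-signature (count cl) k) (cong₂ (λ m s → signature m s k) (edges-cong c) (quads-cong c)))

  δ-refl : ∀ {m} (c : Fin m) → δ c c ≡ 1
  δ-refl c rewrite dec-true (c ≟ c) refl = refl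

  count-positive : ∀ {n m} (f : Fin n → Fin m) c k → count f c ≡ suc k → Σ (Fin n) λ i → f i ≡ c
  count-positive {suc n} f c k e with f zero ≟ c
  ... | yes f0≡c = zero , f0≡c
  ... | no _ with count-positive (f ∘ suc) c k e
  ...   | i , fi≡c = suc i , fi≡c

  count-remove : ∀ {n m} (f : Fin (suc n) → Fin m) i c → count f c ≡ δ (f i) c ℕ.+ count (f ∘ punchIn i) c
  count-remove         f zero    c = refl
  count-remove {suc n} f (suc i) c = trans (cong (δ (f zero) c ℕ.+_) (count-remove (f ∘ suc) i c))
    (lem (δ (f zero) c) (δ (f (suc i)) c) (count (f ∘ suc ∘ punchIn i) c))
    where
    lem : ∀ a b x → a ℕ.+ (b ℕ.+ x) ≡ b ℕ.+ (a ℕ.+ x)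
    lem = solveℕ-∀

  count-self : ∀ {n m} (f : Fin n → Fin m) i → count f (f i) ≢ 0
  count-self {suc n} f i e = ℕ.1+n≢0 (trans (cong (ℕ._+ count (f ∘ punchIn i) (f i)) (sym (δ-refl (f i)))) (trans (sym (count-remove f i (f i))) e))

  -- Vertex 0 is paired with some `j` of the same class; deleting both keeps the counts equal.
  matching : ∀ {n k m} (f : Fin n → Fin m) (g : Fin k → Fin m) → (∀ c → count f c ≡ count g c) →
    Σ (Fin n ↔ Fin k) λ σ → ∀ i → f i ≡ g (Inverse.to σ i)
  matching {zero}  {zero}  f g e = ↔-id _ , λ ()
  matching {zero}  {suc k} f g e = contradiction (sym (e (g zero))) (count-self g zero)
  matching {suc n} {zero}  f g e = contradiction (e (f zero)) (count-self f zero)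
  matching {suc n} {suc k} f g e with count-positive g (f zero) _ (trans (sym (e (f zero))) (cong (ℕ._+ count (f ∘ suc) (f zero)) (δ-refl (f zero))))
  ... | j , gj≡f0 with matching (f ∘ suc) (g ∘ punchIn j) (λ c → ℕ.+-cancelˡ-≡ (δ (f zero) c) _ _
                         (trans (e c) (trans (count-remove g j c) (cong (λ x → δ x c ℕ.+ count (g ∘ punchIn j) c) gj≡f0))))
  ...   | σ , h = insert zero j σ , λ { zero → sym gj≡f0 ; (suc i) → trans (h i) (cong g (sym (insert-punchIn zero j σ i))) }

  weights⇒≅ : ∀ {n m} {G : Graph n} {H : Graph m} {v w} → HasWeights G v → HasWeights H w → (∀ c → v c ≡ w c) → G ≅ H
  weights⇒≅ (weights f a c) (weights g b d) e with matching f g (λ x → trans (c x) (trans (e x) (sym (d x))))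
  ... | σ , h = σ , λ i j → trans (a i j) (trans (cong₂ path (h i) (h j)) (sym (b _ _)))

  weights⇒cospectral : ∀ {n m} {G : Graph n} {H : Graph m} {v w} → n ≡ m → HasWeights G v → HasWeights H w →
    edges v ≡ edges w → quads v ≡ quads w → Cospectral G H
  weights⇒cospectral {G = G} {H} n≡m V W e q = minors⇒cospectral {G = G} {H} n≡m
    (λ k → trans (minors-weights V k) (trans (cong₂ (λ m s → signature m s k) e q) (sym (minors-weights W k))))

  -- `π` permutes the classes with inverse `ϖ` and respects adjacency away from `e`, a class that is
  -- empty where this is applied.
  Relabels : (π ϖ : Fin 6 → Fin 6) → Fin 6 → Set
  Relabels π ϖ e = (∀ c → ϖ (π c) ≡ c) × (∀ c → π (ϖ c) ≡ c) ×
    (∀ c d → (c ≡ e ⊎ d ≡ e) ⊎ path c d ≡ path (π c) (π d))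

  relabel : ∀ {n} {G : Graph n} {w} π ϖ e → Relabels π ϖ e → w e ≡ 0 → HasWeights G w → HasWeights G (w ∘ ϖ)
  relabel {n} {G} {w} π ϖ e (ϖπ , πϖ , compat) we≡0 (weights cl a k) =
    weights (π ∘ cl) (λ i j → trans (a i j) (same (cl i) (cl j) (used i) (used j) (compat (cl i) (cl j))))
            (λ c → trans (count-π cl c) (k (ϖ c)))
    where
    used : ∀ i → cl i ≢ e
    used i eq = count-self cl i (trans (cong (count cl) eq) (trans (k e) we≡0))
    same : ∀ c d → c ≢ e → d ≢ e → (c ≡ e ⊎ d ≡ e) ⊎ path c d ≡ path (π c) (π d) → path c d ≡ path (π c) (π d)
    same c d c≢e d≢e (inj₁ (inj₁ c≡e)) = contradiction c≡e c≢e
    same c d c≢e d≢e (inj₁ (inj₂ d≡e)) = contradiction d≡e d≢e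
    same c d c≢e d≢e (inj₂ eq)         = eq
    δ-π : ∀ x c → δ (π x) c ≡ δ x (ϖ c)
    δ-π x c with x ≟ ϖ c
    ... | yes x≡ϖc rewrite dec-true (π x ≟ c) (trans (cong π x≡ϖc) (πϖ c)) = refl
    ... | no x≢ϖc rewrite dec-false (π x ≟ c) (λ πx≡c → x≢ϖc (trans (sym (ϖπ x)) (cong ϖ πx≡c))) = refl
    count-π : ∀ {n} (f : Fin n → Fin 6) c → count (π ∘ f) c ≡ count f (ϖ c)
    count-π {zero}  f c = refl
    count-π {suc n} f c = cong₂ ℕ._+_ (δ-π (f zero) c) (count-π (f ∘ suc) c)

  relabels? : ∀ π ϖ e → Dec (Relabels π ϖ e)
  relabels? π ϖ e = all? (λ c → ϖ (π c) ≟ c) ×-dec all? (λ c → π (ϖ c) ≟ c) ×-dec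
    all? (λ c → all? λ d → ((c ≟ e) ⊎-dec (d ≟ e)) ⊎-dec (path c d Bool.≟ path (π c) (π d)))

  -- The empty class becomes `4F`: `shiftDown` moves `0F` there, and `reverse4` turns the path on
  -- the other four round.
  shiftDown shiftUp reverse4 : Fin 6 → Fin 6
  shiftDown = lookup (4F ∷ 0F ∷ 1F ∷ 2F ∷ 3F ∷ 5F ∷ [])
  shiftUp   = lookup (1F ∷ 2F ∷ 3F ∷ 4F ∷ 0F ∷ 5F ∷ [])
  reverse4  = lookup (3F ∷ 2F ∷ 1F ∷ 0F ∷ 4F ∷ 5F ∷ [])

  shift-weights : ∀ {n} {G : Graph n} {w} → w 0F ≡ 0 → HasWeights G w → HasWeights G (w ∘ shiftUp)
  shift-weights = relabel shiftDown shiftUp 0F (from-yes (relabels? shiftDown shiftUp 0F))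

  reverse-weights : ∀ {n} {G : Graph n} {w} → w 4F ≡ 0 → HasWeights G w → HasWeights G (w ∘ reverse4)
  reverse-weights = relabel reverse4 reverse4 4F (from-yes (relabels? reverse4 reverse4 4F))

open Weights

-- K⁺ and K⁻ as blow-ups of P₄

module StandardGraphs where

  open import Data.Nat using (_+_; _*_; _<_)

  <ᵇ-true : ∀ {m n} → m < n → (m <ᵇ n) ≡ true
  <ᵇ-true {zero}  (s≤s _)         = refl
  <ᵇ-true {suc m} (s≤s l@(s≤s _)) = <ᵇ-true l

  <ᵇ-false : ∀ {m n} → n ≤ m → (m <ᵇ n) ≡ false
  <ᵇ-false {n = zero}      _       = refl
  <ᵇ-false {suc m} {suc n} (s≤s l) = <ᵇ-false l

  ≡ᵇ-true : ∀ {m n} → m ≡ n → (m ≡ᵇ n) ≡ true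
  ≡ᵇ-true {zero}  refl = refl
  ≡ᵇ-true {suc m} refl = ≡ᵇ-true {m} refl

  ≡ᵇ-false : ∀ {m n} → m ≢ n → (m ≡ᵇ n) ≡ false
  ≡ᵇ-false {zero}  {zero}  h = contradiction refl h
  ≡ᵇ-false {zero}  {suc n} h = refl
  ≡ᵇ-false {suc m} {zero}  h = refl
  ≡ᵇ-false {suc m} {suc n} h = ≡ᵇ-false (h ∘ cong suc)

  count-split : ∀ m {n} (h : ℕ → Fin 6) c →
    count {m + n} (h ∘ toℕ) c ≡ count {m} (h ∘ toℕ) c + count {n} (h ∘ (_+_ m) ∘ toℕ) c
  count-split zero    h c = refl
  count-split (suc m) h c = trans (cong (_+_ (δ (h 0) c)) (count-split m (h ∘ suc) c)) (sym (ℕ.+-assoc (δ (h 0) c) _ _))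

  count-constant : ∀ n (h : ℕ → Fin 6) d c → (∀ a → a < n → h a ≡ d) → count {n} (h ∘ toℕ) c ≡ δ d c * n
  count-constant zero    h d c e = sym (ℕ.*-zeroʳ (δ d c))
  count-constant (suc n) h d c e = trans
    (cong₂ (λ x y → δ x c + y) (e 0 (s≤s z≤n)) (count-constant n (h ∘ suc) d c (λ a l → e (suc a) (s≤s l))))
    (sym (ℕ.*-suc (δ d c) n))

  path-irrefl : ∀ c → path c c ≡ false
  path-irrefl 0F = refl
  path-irrefl 1F = refl
  path-irrefl 2F = refl
  path-irrefl 3F = refl
  path-irrefl 4F = refl
  path-irrefl 5F = refl

  mkGraph-path : ∀ {n} (e : Fin n → Fin n → Bool) (cl : Fin n → Fin 6) →
    (∀ i j → e i j ∨ e j i ≡ path (cl i) (cl j)) → ∀ i j → adj (mkGraph e) i j ≡ path (cl i) (cl j)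
  mkGraph-path e cl h i j with i ≟ j
  ... | yes refl = trans (∧-zeroʳ _) (sym (path-irrefl (cl i)))
  ... | no _     = trans (∧-identityʳ _) (h i j)

  module _ (p q : ℕ) where

    -- The parameters are the outcomes of the comparisons in `Kplus`, and the constructors list the
    -- combinations that occur. Adjacency becomes a finite table.
    data Region⁺ : (z l m t : Bool) → Set where
      first  : Region⁺ true  true  true  false
      small  : Region⁺ false true  true  false
      large  : Region⁺ false false true  false
      extra  : Region⁺ false false false true

    class⁺ : (z l m : Bool) → Fin 6
    class⁺ z l m = if z then 1F else if l then 3F else if m then 2F else 0F

    region⁺ : ∀ a → a < suc p + q + 1 → Region⁺ (a ≡ᵇ 0) (a <ᵇ suc p) (a <ᵇ suc p + q) (a ≡ᵇ suc p + q)
    region⁺ zero    _ = first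
    region⁺ (suc a) (s≤s a<n) with a ℕ.<? p
    ... | yes a<p rewrite <ᵇ-true a<p | <ᵇ-true (ℕ.m≤n⇒m≤n+o q a<p)
                        | ≡ᵇ-false (ℕ.<⇒≢ (ℕ.m≤n⇒m≤n+o q a<p)) = small
    ... | no a≮p rewrite <ᵇ-false (ℕ.≮⇒≥ a≮p) with a ℕ.<? p + q
    ...   | yes a<pq rewrite <ᵇ-true a<pq | ≡ᵇ-false (ℕ.<⇒≢ a<pq) = large
    ...   | no a≮pq rewrite <ᵇ-false (ℕ.≮⇒≥ a≮pq)
                          | ≡ᵇ-true (ℕ.≤-antisym (ℕ.≤-pred (subst (a <_) (ℕ.+-comm (p + q) 1) a<n)) (ℕ.≮⇒≥ a≮pq)) = extra

    adjacent⁺ : ∀ {z l m t z′ l′ m′ t′} → Region⁺ z l m t → Region⁺ z′ l′ m′ t′ →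
      ((l ∧ not l′ ∧ m′) ∨ (z ∧ t′)) ∨ ((l′ ∧ not l ∧ m) ∨ (z′ ∧ t)) ≡ path (class⁺ z l m) (class⁺ z′ l′ m′)
    adjacent⁺ first first = refl
    adjacent⁺ first small = refl
    adjacent⁺ first large = refl
    adjacent⁺ first extra = refl
    adjacent⁺ small first = refl
    adjacent⁺ small small = refl
    adjacent⁺ small large = refl
    adjacent⁺ small extra = refl
    adjacent⁺ large first = refl
    adjacent⁺ large small = refl
    adjacent⁺ large large = refl
    adjacent⁺ large extra = refl
    adjacent⁺ extra first = refl
    adjacent⁺ extra small = refl
    adjacent⁺ extra large = refl
    adjacent⁺ extra extra = refl

    place⁺ : ℕ → Fin 6
    place⁺ a = class⁺ (a ≡ᵇ 0) (a <ᵇ suc p) (a <ᵇ suc p + q)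

    -- Along P₄: the pendant vertex, its neighbour, the part of size `q`, the rest of the other
    -- part.
    weights⁺ : HasWeights (Kplus (suc p) q) (lookup (1 ∷ 1 ∷ q ∷ p ∷ 0 ∷ 0 ∷ []))
    weights⁺ = weights (place⁺ ∘ toℕ)
      (mkGraph-path edge (place⁺ ∘ toℕ) (λ i j → adjacent⁺ (region⁺ (toℕ i) (toℕ<n i)) (region⁺ (toℕ j) (toℕ<n j))))
      (λ c → trans (total c) (tidy c))
      where
      edge : Fin (suc p + q + 1) → Fin (suc p + q + 1) → Bool
      edge i j = ((toℕ i <ᵇ suc p) ∧ not (toℕ j <ᵇ suc p) ∧ (toℕ j <ᵇ suc p + q)) ∨ ((toℕ i ≡ᵇ 0) ∧ (toℕ j ≡ᵇ suc p + q))
      smalls : ∀ a → a < p → place⁺ (suc a) ≡ 3F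
      smalls a l rewrite <ᵇ-true l = refl
      larges : ∀ a → a < q → place⁺ (suc p + a) ≡ 2F
      larges a l rewrite <ᵇ-false (ℕ.m≤m+n p a) | <ᵇ-true (ℕ.+-monoʳ-< p l) = refl
      extras : ∀ a → a < 1 → place⁺ (suc p + q + a) ≡ 0F
      extras a _ rewrite <ᵇ-false (ℕ.≤-trans (ℕ.m≤m+n p q) (ℕ.m≤m+n (p + q) a)) | <ᵇ-false (ℕ.m≤m+n (p + q) a) = refl
      total : ∀ c → count {suc p + q + 1} (place⁺ ∘ toℕ) c ≡ δ 1F c + δ 3F c * p + δ 2F c * q + δ 0F c * 1
      total c = trans (count-split (suc p + q) place⁺ c) (cong₂ _+_
        (trans (count-split (suc p) place⁺ c) (cong₂ _+_
          (cong (_+_ (δ 1F c)) (count-constant p (place⁺ ∘ suc) 3F c smalls))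
          (count-constant q (place⁺ ∘ (_+_ (suc p))) 2F c larges)))
        (count-constant 1 (place⁺ ∘ (_+_ (suc p + q))) 0F c extras))
      one : ∀ n → n + 0 + 0 + 0 ≡ n
      one = solveℕ-∀
      one′ : ∀ n → n + 0 + 0 ≡ n
      one′ = solveℕ-∀
      tidy : ∀ c → δ 1F c + δ 3F c * p + δ 2F c * q + δ 0F c * 1 ≡ lookup (1 ∷ 1 ∷ q ∷ p ∷ 0 ∷ 0 ∷ []) c
      tidy 0F = refl
      tidy 1F = refl
      tidy 2F = one′ q
      tidy 3F = one p
      tidy 4F = refl
      tidy 5F = refl

    data Region⁻ : (z l m t : Bool) → Set where
      first  : Region⁻ true  true  true  false
      small  : Region⁻ false true  true  false
      pivot  : Region⁻ false false true  true
      large  : Region⁻ false false true  false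
      extra  : Region⁻ false false false false

    class⁻ : (z l m t : Bool) → Fin 6
    class⁻ z l m t = if z then 0F else if l then 2F else if t then 3F else if m then 1F else 5F

    region⁻ : ∀ a → Region⁻ (a ≡ᵇ 0) (a <ᵇ suc p) (a <ᵇ suc p + suc q) (a ≡ᵇ suc p)
    region⁻ zero    = first
    region⁻ (suc a) with a ℕ.<? p
    ... | yes a<p rewrite <ᵇ-true a<p | <ᵇ-true (ℕ.m≤n⇒m≤n+o (suc q) a<p) | ≡ᵇ-false (ℕ.<⇒≢ a<p) = small
    ... | no a≮p rewrite <ᵇ-false (ℕ.≮⇒≥ a≮p) with a ℕ.≟ p
    ...   | yes refl rewrite ≡ᵇ-true {a} refl | <ᵇ-true (ℕ.m<m+n a {suc q} (s≤s z≤n)) = pivot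
    ...   | no a≢p rewrite ≡ᵇ-false a≢p with a ℕ.<? p + suc q
    ...     | yes a<pq rewrite <ᵇ-true a<pq = large
    ...     | no a≮pq rewrite <ᵇ-false (ℕ.≮⇒≥ a≮pq) = extra

    adjacent⁻ : ∀ {z l m t z′ l′ m′ t′} → Region⁻ z l m t → Region⁻ z′ l′ m′ t′ →
      (l ∧ not l′ ∧ m′ ∧ not (z ∧ t′)) ∨ (l′ ∧ not l ∧ m ∧ not (z′ ∧ t)) ≡ path (class⁻ z l m t) (class⁻ z′ l′ m′ t′)
    adjacent⁻ first first = refl
    adjacent⁻ first small = refl
    adjacent⁻ first pivot = refl
    adjacent⁻ first large = refl
    adjacent⁻ first extra = refl
    adjacent⁻ small first = refl
    adjacent⁻ small small = refl
    adjacent⁻ small pivot = refl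
    adjacent⁻ small large = refl
    adjacent⁻ small extra = refl
    adjacent⁻ pivot first = refl
    adjacent⁻ pivot small = refl
    adjacent⁻ pivot pivot = refl
    adjacent⁻ pivot large = refl
    adjacent⁻ pivot extra = refl
    adjacent⁻ large first = refl
    adjacent⁻ large small = refl
    adjacent⁻ large pivot = refl
    adjacent⁻ large large = refl
    adjacent⁻ large extra = refl
    adjacent⁻ extra first = refl
    adjacent⁻ extra small = refl
    adjacent⁻ extra pivot = refl
    adjacent⁻ extra large = refl
    adjacent⁻ extra extra = refl

    place⁻ : ℕ → Fin 6
    place⁻ a = class⁻ (a ≡ᵇ 0) (a <ᵇ suc p) (a <ᵇ suc p + suc q) (a ≡ᵇ suc p)

    -- The ends of the deleted edge form the end classes of P₄, and the rests of the two parts form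
    -- the inner ones.
    weights⁻ : ∀ r → HasWeights (KminusIso (suc p) (suc q) r) (lookup (1 ∷ q ∷ p ∷ 1 ∷ 0 ∷ r ∷ []))
    weights⁻ r = weights (place⁻ ∘ toℕ)
      (mkGraph-path edge (place⁻ ∘ toℕ) (λ i j → adjacent⁻ (region⁻ (toℕ i)) (region⁻ (toℕ j))))
      (λ c → trans (total c) (tidy c))
      where
      edge : Fin (suc p + suc q + r) → Fin (suc p + suc q + r) → Bool
      edge i j = (toℕ i <ᵇ suc p) ∧ not (toℕ j <ᵇ suc p) ∧ (toℕ j <ᵇ suc p + suc q) ∧ not ((toℕ i ≡ᵇ 0) ∧ (toℕ j ≡ᵇ suc p))
      smalls : ∀ a → a < p → place⁻ (suc a) ≡ 2F
      smalls a l rewrite <ᵇ-true l = refl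
      pivots : ∀ a → a < 1 → place⁻ (suc p + a) ≡ 3F
      pivots zero _ rewrite ℕ.+-identityʳ p | <ᵇ-false (ℕ.≤-refl {p}) | ≡ᵇ-true {p} refl = refl
      pivots (suc _) (s≤s ())
      larges : ∀ a → a < q → place⁻ (suc p + suc a) ≡ 1F
      larges a l rewrite <ᵇ-false (ℕ.m≤m+n p (suc a)) | ≡ᵇ-false (ℕ.>⇒≢ (ℕ.m<m+n p {suc a} (s≤s z≤n)))
                       | <ᵇ-true (ℕ.+-monoʳ-< p (s≤s l)) = refl
      extras : ∀ a → a < r → place⁻ (suc p + suc q + a) ≡ 5F
      extras a _ rewrite <ᵇ-false (ℕ.≤-trans (ℕ.m≤m+n p (suc q)) (ℕ.m≤m+n (p + suc q) a))
                       | ≡ᵇ-false (ℕ.>⇒≢ (ℕ.<-≤-trans (ℕ.m<m+n p {suc q} (s≤s z≤n)) (ℕ.m≤m+n (p + suc q) a)))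
                       | <ᵇ-false (ℕ.m≤m+n (p + suc q) a) = refl
      total : ∀ c → count {suc p + suc q + r} (place⁻ ∘ toℕ) c ≡ δ 0F c + δ 2F c * p + (δ 3F c * 1 + δ 1F c * q) + δ 5F c * r
      total c = trans (count-split (suc p + suc q) place⁻ c) (cong₂ _+_
        (trans (count-split (suc p) place⁻ c) (cong₂ _+_
          (cong (_+_ (δ 0F c)) (count-constant p (place⁻ ∘ suc) 2F c smalls))
          (trans (count-split 1 {q} (place⁻ ∘ (_+_ (suc p))) c) (cong₂ _+_
            (count-constant 1 (place⁻ ∘ (_+_ (suc p))) 3F c pivots)
            (count-constant q (place⁻ ∘ (_+_ (suc p)) ∘ suc) 1F c larges)))))
        (count-constant r (place⁻ ∘ (_+_ (suc p + suc q))) 5F c extras))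
      one : ∀ n → n + 0 + 0 + 0 ≡ n
      one = solveℕ-∀
      one′ : ∀ n → n + 0 + 0 ≡ n
      one′ = solveℕ-∀
      tidy : ∀ c → δ 0F c + δ 2F c * p + (δ 3F c * 1 + δ 1F c * q) + δ 5F c * r ≡ lookup (1 ∷ q ∷ p ∷ 1 ∷ 0 ∷ r ∷ []) c
      tidy 0F = refl
      tidy 1F = one′ q
      tidy 2F = one p
      tidy 3F = refl
      tidy 4F = refl
      tidy 5F = ℕ.+-identityʳ r

open StandardGraphs

-- The equation E = Q + q + 1 in the class sizes

module Arithmetic where

  open import Data.Nat using (_+_; _*_; _<_)

  -- For K⁺ the number E of edges and the coefficient Q of order 4 satisfy E = Q + q + 1.
  excess : ∀ {Q k E r q} → Q + k ≡ E + r → E ≡ Q + (q + 1) → q + 1 ≤ k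
  excess {Q} {k} {E} {r} {q} e refl =
    subst (q + 1 ≤_) (sym (ℕ.+-cancelˡ-≡ Q k (q + 1 + r) (trans e (ℕ.+-assoc Q (q + 1) r)))) (ℕ.m≤m+n (q + 1) r)

  -- Sizes are written as successors so that the remainder has no negative coefficients and E ≤ Q +
  -- 1 can be read off.
  P5-excess : ∀ a b c d e → let A = 1 + a ; B = 1 + b ; C = 1 + c ; D = 1 + d ; E = 1 + e ; S = A * C + A * E + C * E in
    (A * B * C * D + A * B * D * E + B * C * D * E) + 1 ≡ (A * B + B * C + C * D + D * E) +
      (b * (d * S + A * C + (A + C) * e) + d * (C * E + a * (C + E)) + a * C + e * C + a * e)
  P5-excess = solveℕ-∀

  2K2-excess : ∀ a b d e → let A = 1 + a ; B = 1 + b ; D = 1 + d ; E = 1 + e in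
    (A * B * 0 * D + A * B * D * E + B * 0 * D * E) + 1 ≡ (A * B + B * 0 + 0 * D + D * E) + (a + b + a * b) * (d + e + d * e)
  2K2-excess = solveℕ-∀

  P4-excess : ∀ a b c d → let A = 2 + a ; B = 1 + b ; C = 1 + c ; D = 2 + d ; r = b + a + a * b ; s = c + d + c * d in
    A * B * C * D + 1 ≡ (A * B + B * C + C * D) + (B * s + r * C + r * s)
  P4-excess = solveℕ-∀

  -- An end class of size 1 weakens the bound to E ≤ Q + 2; to contradict E = Q + q + 1 this takes q
  -- ≥ 2.
  P4-excess₁ : ∀ b c d → let B = 2 + b ; C = 1 + c ; D = 2 + d in
    1 * B * C * D + 2 ≡ (1 * B + B * C + C * D) + (d + b * d + c * (b + d + b * d))
  P4-excess₁ = solveℕ-∀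

  -- The solutions of E = Q + q + 1 alone: `left` and its mirror image `right` have the shape of K⁺,
  -- `both` that of a mate. The value of Q enters only in `fromP4`.
  data P4-Solution (q : ℕ) : (a b c d : ℕ) → Set where
    left  : ∀ {d} → P4-Solution q 1 1 q d
    right : ∀ {a} → P4-Solution q a q 1 1
    both  : ∀ {b c} → b + c ≡ q + 1 → P4-Solution q 1 b c 1

  P4-reverse : ∀ {q a b c d} → P4-Solution q a b c d → P4-Solution q d c b a
  P4-reverse left     = right
  P4-reverse right    = left
  P4-reverse (both {b} {c} e) = both (trans (ℕ.+-comm c b) e)

  P4-solve₁ : ∀ q b c d → 2 ≤ q → 1 * b * c * d ≢ 0 →
    1 * b + b * c + c * d ≡ 1 * b * c * d + (q + 1) → P4-Solution q 1 b c d
  P4-solve₁ q zero c d _ nz e = contradiction refl nz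
  P4-solve₁ q b@(suc _) zero d _ nz e = contradiction (cong (_* d) (ℕ.*-zeroʳ (1 * b))) nz
  P4-solve₁ q b@(suc _) c@(suc _) zero _ nz e = contradiction (ℕ.*-zeroʳ (1 * b * c)) nz
  P4-solve₁ q 1 (suc c) (suc d) _ nz e = subst (λ x → P4-Solution q 1 1 x (suc d)) (sym c≡q) left
    where
    lem : ∀ c d → c * d + (c + 1) ≡ 1 * 1 + 1 * c + c * d
    lem = solveℕ-∀
    lem′ : ∀ c d q → 1 * 1 * c * d + (q + 1) ≡ c * d + (q + 1)
    lem′ = solveℕ-∀
    c≡q : suc c ≡ q
    c≡q = ℕ.+-cancelʳ-≡ 1 (suc c) q (ℕ.+-cancelˡ-≡ (suc c * suc d) _ _
      (trans (lem (suc c) (suc d)) (trans e (lem′ (suc c) (suc d) q))))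
  P4-solve₁ q (suc (suc b)) (suc c) 1 _ nz e =
    both (ℕ.+-cancelˡ-≡ ((2 + b) * (1 + c)) _ _ (trans (lem (2 + b) (1 + c)) (trans e (lem′ (2 + b) (1 + c) q))))
    where
    lem : ∀ b c → b * c + (b + c) ≡ 1 * b + b * c + c * 1
    lem = solveℕ-∀
    lem′ : ∀ b c q → 1 * b * c * 1 + (q + 1) ≡ b * c + (q + 1)
    lem′ = solveℕ-∀
  P4-solve₁ q (suc (suc b)) (suc c) (suc (suc d)) 2≤q nz e =
    contradiction (ℕ.≤-trans (ℕ.+-monoˡ-≤ 1 2≤q) (excess (P4-excess₁ b c d) e)) (ℕ.<-irrefl refl)

  P4-solve : ∀ q a b c d → 2 ≤ q → a * b * c * d ≢ 0 →
    a * b + b * c + c * d ≡ a * b * c * d + (q + 1) → P4-Solution q a b c d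
  P4-solve q zero b c d 2≤q nz e = contradiction refl nz
  P4-solve q 1 b c d 2≤q nz e = P4-solve₁ q b c d 2≤q nz e
  P4-solve q a@(suc (suc _)) b c zero 2≤q nz e = contradiction (ℕ.*-zeroʳ (a * b * c)) nz
  P4-solve q a@(suc (suc _)) b c 1 2≤q nz e =
    P4-reverse (P4-solve₁ q c b a 2≤q (nz ∘ trans (lem a b c)) (trans (lem′ a b c) (trans e (cong (_+ (q + 1)) (lem a b c)))))
    where
    lem : ∀ a b c → a * b * c * 1 ≡ 1 * c * b * a
    lem = solveℕ-∀
    lem′ : ∀ a b c → 1 * c + c * b + b * a ≡ a * b + b * c + c * 1
    lem′ = solveℕ-∀
  P4-solve q a@(suc (suc _)) zero c d@(suc (suc _)) 2≤q nz e = contradiction (cong (λ x → x * c * d) (ℕ.*-zeroʳ a)) nz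
  P4-solve q a@(suc (suc _)) b@(suc _) zero d@(suc (suc _)) 2≤q nz e = contradiction (cong (_* d) (ℕ.*-zeroʳ (a * b))) nz
  P4-solve q (suc (suc a)) (suc b) (suc c) (suc (suc d)) 2≤q nz e =
    contradiction (ℕ.≤-trans (ℕ.+-monoˡ-≤ 1 (ℕ.≤-trans (s≤s z≤n) 2≤q)) (excess (P4-excess a b c d) e)) (ℕ.<-irrefl refl)

  -- With both ends occupied, an empty neighbour of an end makes Q zero; otherwise the excess
  -- identities apply.
  end-empty : ∀ q a b c d e → 2 ≤ q → pathQuads a b c d e ≢ 0 → pathEdges a b c d e ≡ pathQuads a b c d e + (q + 1) → a ≡ 0 ⊎ e ≡ 0
  end-empty q zero    b c d e    2≤q nz eq = inj₁ refl
  end-empty q (suc _) b c d zero 2≤q nz eq = inj₂ refl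
  end-empty q a@(suc _) zero c d e@(suc _) 2≤q nz eq = contradiction (lem a c d e) nz
    where
    lem : ∀ a c d e → a * 0 * c * d + a * 0 * d * e + 0 * c * d * e ≡ 0
    lem = solveℕ-∀
  end-empty q a@(suc _) b@(suc _) c zero e@(suc _) 2≤q nz eq = contradiction (lem a b c e) nz
    where
    lem : ∀ a b c e → a * b * c * 0 + a * b * 0 * e + b * c * 0 * e ≡ 0
    lem = solveℕ-∀
  end-empty q (suc a) (suc b) zero (suc d) (suc e) 2≤q nz eq =
    contradiction (ℕ.≤-trans (ℕ.+-monoˡ-≤ 1 (ℕ.≤-trans (s≤s z≤n) 2≤q)) (excess (2K2-excess a b d e) eq)) (ℕ.<-irrefl refl)
  end-empty q (suc a) (suc b) (suc c) (suc d) (suc e) 2≤q nz eq =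
    contradiction (ℕ.≤-trans (ℕ.+-monoˡ-≤ 1 (ℕ.≤-trans (s≤s z≤n) 2≤q)) (excess (P5-excess a b c d e) eq)) (ℕ.<-irrefl refl)

open Arithmetic

-- Cospectral mates of K⁺ and the quadratic equation

module CospectralMates where

  open import Data.Nat using (_+_; _*_; _<_)

  open HasWeights

  count-total : ∀ {n} (f : Fin n → Fin 6) → count f 0F + count f 1F + count f 2F + count f 3F + count f 4F + count f 5F ≡ n
  count-total {zero}  f = refl
  count-total {suc n} f = trans
    (lem (δ (f zero) 0F) (δ (f zero) 1F) (δ (f zero) 2F) (δ (f zero) 3F) (δ (f zero) 4F) (δ (f zero) 5F) _ _ _ _ _ _)
    (cong₂ _+_ (total (f zero)) (count-total (f ∘ suc)))
    where
    lem : ∀ a b c d e z a′ b′ c′ d′ e′ z′ →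
      (a + a′) + (b + b′) + (c + c′) + (d + d′) + (e + e′) + (z + z′) ≡ (a + b + c + d + e + z) + (a′ + b′ + c′ + d′ + e′ + z′)
    lem = solveℕ-∀
    total : ∀ c → δ c 0F + δ c 1F + δ c 2F + δ c 3F + δ c 4F + δ c 5F ≡ 1
    total 0F = refl
    total 1F = refl
    total 2F = refl
    total 3F = refl
    total 4F = refl
    total 5F = refl

  weights-total : ∀ {n} {G : Graph n} {w} → HasWeights G w → w 0F + w 1F + w 2F + w 3F + w 4F + w 5F ≡ n
  weights-total (weights f _ c) rewrite sym (c 0F) | sym (c 1F) | sym (c 2F) | sym (c 3F) | sym (c 4F) | sym (c 5F) = count-total f

  reweigh : ∀ {n} {G : Graph n} {v w} → (∀ c → v c ≡ w c) → HasWeights G v → HasWeights G w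
  reweigh e (weights f a c) = weights f a (λ x → trans (c x) (e x))

  pointwise : ∀ (v w : Fin 6 → ℕ) → v 0F ≡ w 0F → v 1F ≡ w 1F → v 2F ≡ w 2F → v 3F ≡ w 3F → v 4F ≡ w 4F → v 5F ≡ w 5F → ∀ c → v c ≡ w c
  pointwise v w e₀ e₁ e₂ e₃ e₄ e₅ 0F = e₀
  pointwise v w e₀ e₁ e₂ e₃ e₄ e₅ 1F = e₁
  pointwise v w e₀ e₁ e₂ e₃ e₄ e₅ 2F = e₂
  pointwise v w e₀ e₁ e₂ e₃ e₄ e₅ 3F = e₃
  pointwise v w e₀ e₁ e₂ e₃ e₄ e₅ 4F = e₄
  pointwise v w e₀ e₁ e₂ e₃ e₄ e₅ 5F = e₅

  -- The parameter p is one less than that of the theorem.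
  module _ (p q : ℕ) (2≤p : 2 ≤ p) (2≤q : 2 ≤ q) where

    K : Graph (suc p + q + 1)
    K = Kplus (suc p) q

    -- `b` and `c` are one less than the roots of the quadratic; the `p ∸ 1` isolated vertices make
    -- the orders agree.
    Mate : ∀ {m} → Graph m → ℕ → ℕ → Set
    Mate H b c = b + c ≡ q + 1 × b * c ≡ q * p × HasWeights H (lookup (1 ∷ b ∷ c ∷ 1 ∷ 0 ∷ (p ∸ 1) ∷ []))

    q*p≢0 : q * p ≢ 0
    q*p≢0 e = [ (λ q≡0 → ℕ.<⇒≢ (ℕ.≤-trans (s≤s z≤n) 2≤q) (sym q≡0))
              , (λ p≡0 → ℕ.<⇒≢ (ℕ.≤-trans (s≤s z≤n) 2≤p) (sym p≡0)) ]′ (ℕ.m*n≡0⇒m≡0∨n≡0 q e)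

    edges⁺ : edges (lookup (1 ∷ 1 ∷ q ∷ p ∷ 0 ∷ 0 ∷ [])) ≡ q * p + (q + 1)
    edges⁺ = lem p q
      where
      lem : ∀ p q → 1 * 1 + 1 * q + q * p + p * 0 ≡ q * p + (q + 1)
      lem = solveℕ-∀

    quads⁺ : quads (lookup (1 ∷ 1 ∷ q ∷ p ∷ 0 ∷ 0 ∷ [])) ≡ q * p
    quads⁺ = lem p q
      where
      lem : ∀ p q → 1 * 1 * q * p + 1 * 1 * p * 0 + 1 * q * p * 0 ≡ q * p
      lem = solveℕ-∀

    module _ (m : ℕ) (H : Graph m) (m≡ : suc p + q + 1 ≡ m) where

      fromP4 : ∀ {a b c d e z} → P4-Solution q a b c d → e ≡ 0 → a * b * c * d ≡ q * p →
        HasWeights H (lookup (a ∷ b ∷ c ∷ d ∷ e ∷ z ∷ [])) → K ≅ H ⊎ Σ ℕ λ b → Σ ℕ λ c → Mate H b c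
      fromP4 {d = d} {z = z} left refl s W =
        inj₁ (weights⇒≅ (weights⁺ p q) W (pointwise _ _ refl refl refl (sym d≡p) refl (sym z≡0)))
        where
        lem : ∀ q d → 1 * 1 * q * d ≡ q * d
        lem = solveℕ-∀
        d≡p : d ≡ p
        d≡p = ℕ.*-cancelˡ-≡ d p q {{ℕ.>-nonZero (ℕ.≤-trans (s≤s z≤n) 2≤q)}} (trans (sym (lem q d)) s)
        lem′ : ∀ d q z → 1 + 1 + q + d + 0 + z ≡ 1 + d + q + 1 + z
        lem′ = solveℕ-∀
        z≡0 : z ≡ 0
        z≡0 = ℕ.+-cancelˡ-≡ (1 + d + q + 1) z 0 (trans (sym (lem′ d q z)) (trans (weights-total W) (trans (sym m≡)
          (trans (cong (λ x → suc x + q + 1) (sym d≡p)) (sym (ℕ.+-identityʳ _))))))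
      fromP4 right refl s W = fromP4 left refl (trans (lem _ q) s)
        (reweigh (pointwise _ (lookup (1 ∷ 1 ∷ q ∷ _ ∷ 0 ∷ _ ∷ [])) refl refl refl refl refl refl) (reverse-weights refl W))
        where
        lem : ∀ a q → 1 * 1 * q * a ≡ a * q * 1 * 1
        lem = solveℕ-∀
      fromP4 {b = b} {c} {z = z} (both b+c) refl s W = inj₂ (b , c , b+c , trans (sym (lem b c)) s ,
        reweigh (pointwise _ _ refl refl refl refl refl z≡) W)
        where
        lem : ∀ b c → 1 * b * c * 1 ≡ b * c
        lem = solveℕ-∀
        lem′ : ∀ b c z → 1 + b + c + 1 + 0 + z ≡ b + c + 1 + (1 + z)
        lem′ = solveℕ-∀
        lem″ : ∀ p q → 1 + p + q + 1 ≡ q + 1 + 1 + p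
        lem″ = solveℕ-∀
        z≡ : z ≡ p ∸ 1
        z≡ = cong (_∸ 1) (ℕ.+-cancelˡ-≡ (q + 1 + 1) (1 + z) p (trans (cong (λ x → x + 1 + (1 + z)) (sym b+c))
          (trans (sym (lem′ b c z)) (trans (weights-total W) (trans (sym m≡) (lem″ p q))))))

      tabulated : ∀ {w} → HasWeights H w → HasWeights H (lookup (w 0F ∷ w 1F ∷ w 2F ∷ w 3F ∷ w 4F ∷ w 5F ∷ []))
      tabulated = reweigh (pointwise _ _ refl refl refl refl refl refl)

      fromWeights : ∀ {w} → HasWeights H w → edges w ≡ quads w + (q + 1) → quads w ≡ q * p →
        K ≅ H ⊎ Σ ℕ λ b → Σ ℕ λ c → Mate H b c
      fromWeights {w} W e s with end-empty q (w 0F) (w 1F) (w 2F) (w 3F) (w 4F) 2≤q (λ z → q*p≢0 (trans (sym s) z)) e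
      ... | inj₁ w0≡0 = fromP4
            (P4-solve q (w 1F) (w 2F) (w 3F) (w 4F) 2≤q (λ z → q*p≢0 (trans (sym s′) z)) (trans e′ (cong (_+ (q + 1)) s″)))
            w0≡0 s′ (tabulated (shift-weights w0≡0 W))
            where
            lemE : ∀ {a} b c d e → a ≡ 0 → pathEdges a b c d e ≡ b * c + c * d + d * e
            lemE b c d e refl = refl
            lemQ : ∀ {a} b c d e → a ≡ 0 → pathQuads a b c d e ≡ b * c * d * e
            lemQ b c d e refl = refl
            s″ : quads w ≡ w 1F * w 2F * w 3F * w 4F
            s″ = lemQ (w 1F) (w 2F) (w 3F) (w 4F) w0≡0
            s′ = trans (sym s″) s
            e′ = trans (sym (lemE (w 1F) (w 2F) (w 3F) (w 4F) w0≡0)) e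
      ... | inj₂ w4≡0 = fromP4
            (P4-solve q (w 0F) (w 1F) (w 2F) (w 3F) 2≤q (λ z → q*p≢0 (trans (sym s′) z)) (trans e′ (cong (_+ (q + 1)) s″)))
            w4≡0 s′ (tabulated W)
            where
            lemE : ∀ a b c d → a * b + b * c + c * d + d * 0 ≡ a * b + b * c + c * d
            lemE = solveℕ-∀
            lemQ : ∀ a b c d → a * b * c * d + a * b * d * 0 + b * c * d * 0 ≡ a * b * c * d
            lemQ = solveℕ-∀
            s″ : quads w ≡ w 0F * w 1F * w 2F * w 3F
            s″ = trans (cong (pathQuads (w 0F) (w 1F) (w 2F) (w 3F)) w4≡0) (lemQ (w 0F) (w 1F) (w 2F) (w 3F))
            s′ = trans (sym s″) s
            e′ = trans (sym (trans (cong (pathEdges (w 0F) (w 1F) (w 2F) (w 3F)) w4≡0) (lemE (w 0F) (w 1F) (w 2F) (w 3F)))) e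

    minors⁺ : ∀ {m} {H : Graph m} → Cospectral K H → ∀ k → minors H k ≡ signature (q * p + (q + 1)) (q * p) k
    minors⁺ {H = H} cs k = trans (sym (cospectral⇒minors {G = K} {H} cs k))
      (trans (minors-weights (weights⁺ p q) k) (cong₂ (λ m s → signature m s k) edges⁺ quads⁺))

    fromClassified : ∀ {m} (H : Graph m) → Cospectral K H → Classified H → K ≅ H ⊎ Σ ℕ λ b → Σ ℕ λ c → Mate H b c
    fromClassified {m} H cs (cl , a) = fromWeights m H (proj₁ cs) W e s
      where
      W : HasWeights H (count cl)
      W = weights cl a (λ _ → refl)
      s : quads (count cl) ≡ q * p
      s = ℤ.+-injective (trans (sym (minors-weights W 4)) (minors⁺ {H = H} cs 4))
      e : edges (count cl) ≡ quads (count cl) + (q + 1)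
      e = trans (ℤ.+-injective (ℤ.neg-injective (trans (sym (minors-weights W 2)) (minors⁺ {H = H} cs 2)))) (cong (_+ (q + 1)) (sym s))

    mates : ∀ {m} (H : Graph m) → Cospectral K H → K ≅ H ⊎ Σ ℕ λ b → Σ ℕ λ c → Mate H b c
    mates H cs = fromClassified H cs
      (Structure.classification H (minors⁺ {H = H} cs 3) (minors⁺ {H = H} cs 5) (minors⁺ {H = H} cs 6)
        (λ z → q*p≢0 (ℤ.+-injective (trans (sym (minors⁺ {H = H} cs 4)) z))))

    -- K⁺ has no isolated vertex, whereas a mate has `p ∸ 1` of them, at least one; this tells them
    -- apart.
    neighbour : ∀ i → Σ (Fin (suc p + q + 1)) λ j → adj K i j ≡ true
    neighbour i = next (place⁺ p q (toℕ i)) refl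
      where
      W = weights⁺ p q
      cl = class W
      to : ∀ {c} → cl i ≡ c → ∀ d k → count cl d ≡ suc k → path c d ≡ true → Σ (Fin (suc p + q + 1)) λ j → adj K i j ≡ true
      to eq d k e pcd with count-positive cl d k e
      ... | j , clj≡d = j , trans (adjacent W i j) (trans (cong₂ path eq clj≡d) pcd)
      q≡1+ : q ≡ suc (ℕ.pred q)
      q≡1+ = sym (ℕ.suc-pred q {{ℕ.>-nonZero (ℕ.≤-trans (s≤s z≤n) 2≤q)}})
      next : ∀ c → cl i ≡ c → Σ (Fin (suc p + q + 1)) λ j → adj K i j ≡ true
      next 0F eq = to eq 1F 0 (counts W 1F) refl
      next 1F eq = to eq 0F 0 (counts W 0F) refl
      next 2F eq = to eq 1F 0 (counts W 1F) refl
      next 3F eq = to eq 2F (ℕ.pred q) (trans (counts W 2F) q≡1+) refl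
      next 4F eq = contradiction (trans (cong (count cl) eq) (counts W 4F)) (count-self cl i)
      next 5F eq = contradiction (trans (cong (count cl) eq) (counts W 5F)) (count-self cl i)

    isolated : ∀ d → path 5F d ≡ false
    isolated 0F = refl
    isolated 1F = refl
    isolated 2F = refl
    isolated 3F = refl
    isolated 4F = refl
    isolated 5F = refl

    noIsolated : ∀ {m} {H : Graph m} {w k} → HasWeights H w → w 5F ≡ suc k → ¬ (K ≅ H)
    noIsolated {m} {H} {k = k} W e (σ , h) with count-positive (class W) 5F k (trans (counts W 5F) e)
    ... | v , cv with neighbour (Inverse.from σ v)
    ...   | j , edge = contradiction (trans (sym (isolated (class W (Inverse.to σ j))))
            (trans (cong (λ c → path c (class W (Inverse.to σ j))) (sym cv))
            (trans (sym (adjacent W v (Inverse.to σ j)))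
            (trans (cong (λ u → adj H u (Inverse.to σ j)) (sym (Inverse.strictlyInverseˡ σ v)))
            (trans (sym (h (Inverse.from σ v) j)) edge))))) (λ ())

    module _ (P Q : ℕ) (P+Q : P + Q ≡ q + 1) (P*Q : P * Q ≡ q * p) where

      K⁻ : Graph (suc P + suc Q + (p ∸ 1))
      K⁻ = KminusIso (suc P) (suc Q) (p ∸ 1)

      mate⁻ : HasWeights K⁻ (lookup (1 ∷ Q ∷ P ∷ 1 ∷ 0 ∷ (p ∸ 1) ∷ []))
      mate⁻ = weights⁻ P Q (p ∸ 1)

      p≡ : p ≡ suc (p ∸ 1)
      p≡ = sym (ℕ.m+[n∸m]≡n (ℕ.≤-trans (s≤s z≤n) 2≤p))

      cospectral⁻ : Cospectral K K⁻
      cospectral⁻ = weights⇒cospectral {G = K} {H = K⁻} order (weights⁺ p q) mate⁻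
        (trans edges⁺ (trans (cong₂ _+_ (sym P*Q) (sym P+Q)) (lemE P Q))) (trans quads⁺ (trans (sym P*Q) (lemQ P Q)))
        where
        lemE : ∀ P Q → P * Q + (P + Q) ≡ 1 * Q + Q * P + P * 1 + 1 * 0
        lemE = solveℕ-∀
        lemQ : ∀ P Q → P * Q ≡ 1 * Q * P * 1 + 1 * Q * 1 * 0 + Q * P * 1 * 0
        lemQ = solveℕ-∀
        lemL : ∀ r q → 1 + (1 + r) + q + 1 ≡ q + 1 + (2 + r)
        lemL = solveℕ-∀
        lemR : ∀ r P Q → P + Q + (2 + r) ≡ 1 + P + (1 + Q) + r
        lemR = solveℕ-∀
        order : suc p + q + 1 ≡ suc P + suc Q + (p ∸ 1)
        order = trans (cong (λ x → suc x + q + 1) p≡) (trans (lemL (p ∸ 1) q)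
          (trans (cong (_+ (2 + (p ∸ 1))) (sym P+Q)) (lemR (p ∸ 1) P Q)))

      notIsomorphic : ¬ (K ≅ K⁻)
      notIsomorphic = noIsolated mate⁻ (sym (ℕ.m+[n∸m]≡n (ℕ.∸-monoˡ-≤ 1 2≤p)))

      -- Sum and product determine `b` and `c` up to order, and reversing the path exchanges them.
      mate-unique : ∀ {m} {H : Graph m} {b c} → Mate H b c → H ≅ K⁻
      mate-unique {b = b} {c} (b+c , b*c , W) with sameRoots b c P Q (trans b+c (sym P+Q)) (trans b*c (sym P*Q))
        where
        -- Here P is b + k and c is k + Q, so equality of the products reduces to k b = k Q.
        ordered : ∀ b k P Q → b + (k + Q) ≡ (b + k) + Q → b * (k + Q) ≡ (b + k) * Q → b ≡ Q ⊎ k ≡ 0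
        ordered b zero    P Q s t = inj₂ refl
        ordered b (suc k) P Q s t = inj₁ (ℕ.*-cancelˡ-≡ b Q (suc k) (ℕ.+-cancelˡ-≡ (b * Q) _ _ (trans (lem b k Q) (trans t (lem′ b k Q)))))
          where
          lem : ∀ b k Q → b * Q + (1 + k) * b ≡ b * (1 + k + Q)
          lem = solveℕ-∀
          lem′ : ∀ b k Q → (b + (1 + k)) * Q ≡ b * Q + (1 + k) * Q
          lem′ = solveℕ-∀
        sameRoots≤ : ∀ b c P Q → b ≤ P → b + c ≡ P + Q → b * c ≡ P * Q → (b ≡ P × c ≡ Q) ⊎ (b ≡ Q × c ≡ P)
        sameRoots≤ b c P Q b≤P s t with ℕ.m≤n⇒∃[o]m+o≡n b≤P
        ... | k , refl with ℕ.+-cancelˡ-≡ b c (k + Q) (trans s (ℕ.+-assoc b k Q))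
        ...   | refl with ordered b k P Q (sym (ℕ.+-assoc b k Q)) t
        ...     | inj₁ refl = inj₂ (refl , ℕ.+-comm k b)
        ...     | inj₂ refl = inj₁ (sym (ℕ.+-identityʳ b) , refl)
        sameRoots : ∀ b c P Q → b + c ≡ P + Q → b * c ≡ P * Q → (b ≡ P × c ≡ Q) ⊎ (b ≡ Q × c ≡ P)
        sameRoots b c P Q s t with ℕ.≤-total b P
        ... | inj₁ b≤P = sameRoots≤ b c P Q b≤P s t
        ... | inj₂ P≤b with sameRoots≤ P Q b c P≤b (sym s) (sym t)
        ...   | inj₁ (e , f) = inj₁ (sym e , sym f)
        ...   | inj₂ (e , f) = inj₂ (sym f , sym e)
      ... | inj₁ (refl , refl) = weights⇒≅ (reverse-weights refl W) mate⁻ (pointwise _ _ refl refl refl refl refl refl)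
      ... | inj₂ (refl , refl) = weights⇒≅ W mate⁻ (λ _ → refl)

    Roots : Set
    Roots = Σ ℕ λ p″ → Σ ℕ λ q″ → 2 ≤ p″ × p″ ≤ q″ × RootsOf (suc p) q p″ q″

    -- The roots P + 1 and Q + 1 have sum q + 3 and product q p + (q + 1) + 1, which is (p + 1) q +
    -- 2.
    roots-intro : ∀ P Q → P + Q ≡ q + 1 → P * Q ≡ q * p → RootsOf (suc p) q (suc P) (suc Q)
    roots-intro P Q s t x = trans (cong₂ (λ a b → x ℤ.* x ℤ.- a ℤ.* x ℤ.+ b)
        (trans (cong +_ sum) (ℤ.pos-+ (suc P) (suc Q))) (trans (cong +_ prod) (ℤ.pos-* (suc P) (suc Q))))
        (lem x (+ suc P) (+ suc Q))
      where
      lem : ∀ x a b → x ℤ.* x ℤ.- (a ℤ.+ b) ℤ.* x ℤ.+ a ℤ.* b ≡ (x ℤ.- a) ℤ.* (x ℤ.- b)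
      lem = solve-∀
      lem₁ : ∀ q → q + 3 ≡ q + 1 + 2
      lem₁ = solveℕ-∀
      lem₂ : ∀ P Q → P + Q + 2 ≡ (1 + P) + (1 + Q)
      lem₂ = solveℕ-∀
      sum : q + 3 ≡ suc P + suc Q
      sum = trans (lem₁ q) (trans (cong (_+ 2) (sym s)) (lem₂ P Q))
      lem₃ : ∀ p q → (1 + p) * q + 2 ≡ q * p + (q + 1) + 1
      lem₃ = solveℕ-∀
      lem₄ : ∀ P Q → P * Q + (P + Q) + 1 ≡ (1 + P) * (1 + Q)
      lem₄ = solveℕ-∀
      prod : suc p * q + 2 ≡ suc P * suc Q
      prod = trans (lem₃ p q) (trans (cong₂ (λ a b → a + b + 1) (sym t) (sym s)) (lem₄ P Q))

    -- The identity at x = 0 gives the product of the roots, and then at x = 1 their sum.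
    roots-elim : ∀ P Q → RootsOf (suc p) q (suc P) (suc Q) → P + Q ≡ q + 1 × P * Q ≡ q * p
    roots-elim P Q r = s , ℕ.+-cancelʳ-≡ (q + 1 + 1) _ _
        (trans (cong (λ x → P * Q + (x + 1)) (sym s)) (trans (lem₂ P Q) (trans (sym (ℤ.+-injective prod)) (lem₃ p q))))
      where
      A = + (q + 3)
      B = + (suc p * q + 2)
      at0 : ∀ A B a b → + 0 ℤ.* + 0 ℤ.- A ℤ.* + 0 ℤ.+ B ≡ (+ 0 ℤ.- a) ℤ.* (+ 0 ℤ.- b) → B ≡ a ℤ.* b
      at0 A B a b e = trans (lemL A B) (trans e (lemR a b))
        where
        lemL : ∀ A B → B ≡ + 0 ℤ.* + 0 ℤ.- A ℤ.* + 0 ℤ.+ B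
        lemL = solve-∀
        lemR : ∀ a b → (+ 0 ℤ.- a) ℤ.* (+ 0 ℤ.- b) ≡ a ℤ.* b
        lemR = solve-∀
      at1 : ∀ A B a b → + 1 ℤ.* + 1 ℤ.- A ℤ.* + 1 ℤ.+ B ≡ (+ 1 ℤ.- a) ℤ.* (+ 1 ℤ.- b) → B ≡ a ℤ.* b → A ≡ a ℤ.+ b
      at1 A B a b e f = trans (lemL A B) (trans (cong₂ (λ x y → + 1 ℤ.+ x ℤ.- y) f e) (lemR a b))
        where
        lemL : ∀ A B → A ≡ + 1 ℤ.+ B ℤ.- (+ 1 ℤ.* + 1 ℤ.- A ℤ.* + 1 ℤ.+ B)
        lemL = solve-∀
        lemR : ∀ a b → + 1 ℤ.+ a ℤ.* b ℤ.- (+ 1 ℤ.- a) ℤ.* (+ 1 ℤ.- b) ≡ a ℤ.+ b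
        lemR = solve-∀
      product : B ≡ + suc P ℤ.* + suc Q
      product = at0 A B (+ suc P) (+ suc Q) (r (+ 0))
      prod : B ≡ + (suc P * suc Q)
      prod = trans product (sym (ℤ.pos-* (suc P) (suc Q)))
      sum : q + 3 ≡ suc P + suc Q
      sum = ℤ.+-injective (trans (at1 A B (+ suc P) (+ suc Q) (r (+ 1)) product) (sym (ℤ.pos-+ (suc P) (suc Q))))
      lem₁ : ∀ q → q + 3 ≡ q + 1 + 2
      lem₁ = solveℕ-∀
      lem₀ : ∀ P Q → P + Q + 2 ≡ (1 + P) + (1 + Q)
      lem₀ = solveℕ-∀
      s : P + Q ≡ q + 1
      s = ℕ.+-cancelʳ-≡ 2 _ _ (trans (lem₀ P Q) (trans (sym sum) (lem₁ q)))
      lem₂ : ∀ P Q → P * Q + (P + Q + 1) ≡ (1 + P) * (1 + Q)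
      lem₂ = solveℕ-∀
      lem₃ : ∀ p q → (1 + p) * q + 2 ≡ q * p + (q + 1 + 1)
      lem₃ = solveℕ-∀

    factors⇒Roots : ∀ b c → b + c ≡ q + 1 → b * c ≡ q * p → Roots
    factors⇒Roots zero    c       s t = contradiction (sym t) q*p≢0
    factors⇒Roots (suc b) zero    s t = contradiction (trans (sym t) (ℕ.*-zeroʳ b)) q*p≢0
    factors⇒Roots (suc b) (suc c) s t with ℕ.≤-total b c
    ... | inj₁ b≤c = 2 + b , 2 + c , s≤s (s≤s z≤n) , s≤s (s≤s b≤c) , roots-intro (suc b) (suc c) s t
    ... | inj₂ c≤b = 2 + c , 2 + b , s≤s (s≤s z≤n) , s≤s (s≤s c≤b) ,
                     roots-intro (suc c) (suc b) (trans (ℕ.+-comm (suc c) (suc b)) s) (trans (ℕ.*-comm (suc c) (suc b)) t)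

    notDS⇒Roots : ¬ DS K → Roots
    -- `¬ DS K` yields no cospectral graph constructively. Instead a factorisation is searched for
    -- among all b ≤ q + 1; if there is none, K⁺ has no mate and is determined by its spectrum.
    notDS⇒Roots ¬ds with any? {n = 2 + q} (λ b → toℕ b * (q + 1 ∸ toℕ b) ℕ.≟ q * p)
    ... | yes (b , t) = factors⇒Roots (toℕ b) (q + 1 ∸ toℕ b)
            (ℕ.m+[n∸m]≡n (subst (toℕ b ≤_) (ℕ.+-comm 1 q) (ℕ.≤-pred (toℕ<n b)))) t
    ... | no none = ⊥-elim (¬ds ds)
      where
      found : ∀ {m} {H : Graph m} → (Σ ℕ λ b → Σ ℕ λ c → Mate H b c) →
        Σ (Fin (2 + q)) λ b → toℕ b * (q + 1 ∸ toℕ b) ≡ q * p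
      found (b , c , s , t , _) = fromℕ< b<2+q , trans (cong (λ x → x * (q + 1 ∸ x)) (toℕ-fromℕ< b<2+q))
        (trans (cong (λ x → b * (x ∸ b)) (sym s)) (trans (cong (b *_) (ℕ.m+n∸m≡n b c)) t))
        where
        b<2+q : b < 2 + q
        b<2+q = s≤s (subst (b ≤_) (trans s (ℕ.+-comm q 1)) (ℕ.m≤m+n b c))
      ds : DS K
      ds H cs = [ id , (λ mate → contradiction (found mate) none) ]′ (mates H cs)

open CospectralMates

theorem4p1 : (p q : ℕ) → 3 ≤ p → p ≤ q →
    ((¬ DS (Kplus p q)) ⇔ (Σ ℕ λ p'' → Σ ℕ λ q'' → 2 ≤ p'' × p'' ≤ q'' × RootsOf p q p'' q''))
    × (¬ DS (Kplus p q) → (p'' q'' : ℕ) → 2 ≤ p'' → p'' ≤ q'' → RootsOf p q p'' q'' →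
    Cospectral (Kplus p q) (KminusIso p'' q'' (p ∸ 2))
    × ¬ (Kplus p q ≅ KminusIso p'' q'' (p ∸ 2))
    × (∀ {m} (H : Graph m) → Cospectral (Kplus p q) H → ¬ (Kplus p q ≅ H) →
    H ≅ KminusIso p'' q'' (p ∸ 2)))
theorem4p1 (suc p) q (s≤s 2≤p) p<q = mk⇔ (notDS⇒Roots p q 2≤p 2≤q) notDS , λ _ → mate
  where
  2≤q : 2 ≤ q
  2≤q = ℕ.≤-trans 2≤p (ℕ.<⇒≤ p<q)
  mate : (p'' q'' : ℕ) → 2 ≤ p'' → p'' ≤ q'' → RootsOf (suc p) q p'' q'' →
    Cospectral (Kplus (suc p) q) (KminusIso p'' q'' (p ∸ 1))
    × ¬ (Kplus (suc p) q ≅ KminusIso p'' q'' (p ∸ 1))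
    × (∀ {m} (H : Graph m) → Cospectral (Kplus (suc p) q) H → ¬ (Kplus (suc p) q ≅ H) → H ≅ KminusIso p'' q'' (p ∸ 1))
  mate (suc P) (suc Q) _ _ r with roots-elim p q 2≤p 2≤q P Q r
  ... | s , t = cospectral⁻ p q 2≤p 2≤q P Q s t , notIsomorphic p q 2≤p 2≤q P Q s t ,
    λ H cs ≇ → [ (λ iso → contradiction iso ≇) , (λ { (_ , _ , m) → mate-unique p q 2≤p 2≤q P Q s t m }) ]′ (mates p q 2≤p 2≤q H cs)
  notDS : (Σ ℕ λ p'' → Σ ℕ λ q'' → 2 ≤ p'' × p'' ≤ q'' × RootsOf (suc p) q p'' q'') → ¬ DS (Kplus (suc p) q)
  notDS (p'' , q'' , l , l′ , r) ds with mate p'' q'' l l′ r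
  ... | cs , ≇ , _ = ≇ (ds (KminusIso p'' q'' (p ∸ 1)) cs)
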